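{- Let $K$ be an algebraically closed field complete with respect to a nontrivial nonarchimedean absolute value, let $\varphi:\mathbb{P}^N_K\to\mathbb{P}^N_K$ be a morphism of degree $d\ge2$, let $\Phi$ be a lift of $\varphi$, and let $\hat g_\Phi:\mathbb{P}^N(K)\to\mathbb{R}$ be the modified Green function. Let $u=\max\{2d,\ |\operatorname{Res}(\varphi)|^{ -2}\}$. Then for all $P,Q\in\mathbb{P}^N(K)$, $$|\hat g_\Phi(P)-\hat g_\Phi(Q)|\le\frac{2u\log u}{d}\,\Delta(P,Q)^{\frac{\log d}{\log u}}.$$ In particular $\hat g_\Phi$ is Hölder continuous.
   Context: For $x\in K^{N+1}$, $\|x\|=\max_i|x_i|$, and $\pi:K^{N+1}\setminus\{0\}\to\mathbb{P}^N(K)$ is the projection. The chordal distance of $P=\pi(x)$, $Q=\pi(y)$ is $\Delta(P,Q)=\max_{i,j}|x_iy_j-x_jy_i|/(\|x\|\,\|y\|)$. A lift of $\varphi$ is a tuple $\Phi=(\Phi_0,\dots,\Phi_N)$ of degree-$d$ homogeneous polynomials over $K$ with no common nontrivial zero and $\varphi\circ\pi=\pi\circ\Phi$; $\|\Phi\|$ is the maximum absolute value of its coefficients, and $\Phi$ is minimal if $\|\Phi\|=1$. $\operatorname{Res}(\varphi)$ is the Macaulay resultant of a minimal lift ($|\operatorname{Res}(\varphi)|$ is well defined, $0<|\operatorname{Res}(\varphi)|\le1$). The Green function is $G_\Phi(x)=\lim_{n\to\infty}d^{ -n}\log\|\Phi^n(x)\|$ (the limit exists) and $\hat g_\Phi(P)=G_\Phi(x)-\log\|x\|$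 for $x\in\pi^{ -1}(P)$. -}

module Defs where

open import Algebra.Bundles using (CommutativeRing; Semiring)
import Algebra.Construct.NaturalChoice.Max as Max
import Algebra.Definitions.RawSemiring as RawSemiringDefinitions
open import Data.Fin.Base using (Fin; zero; suc; toℕ)
open import Data.Integer.Base using (ℤ; 0ℤ; 1ℤ)
import Data.Integer.Properties as ℤ
open import Data.List.Base as List using (List; []; _∷_; _++_)
open import Data.Nat.Base as ℕ using (ℕ; zero; suc)
open import Data.Nat.GeneralisedArithmetic using (fold)
import Data.Nat.Properties as ℕ
open import Data.Product.Base using (∃; Σ; _×_; _,_; proj₁; proj₂)
open import Data.Vec.Functional as Vec using (Vector)
open import Function.Base using (_∘_)
open import Function.Bundles using (Func; _⇔_)
open import Level using (Level; 0ℓ) renaming (_⊔_ to _⊔ˡ_; suc to lsuc)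
open import Relation.Binary.Bundles using (Setoid; TotalOrder)
open import Relation.Binary.Core using (Rel)
open import Relation.Binary.Definitions using (Decidable)
open import Relation.Binary.PropositionalEquality.Core using (_≡_)
import Relation.Binary.Construct.NonStrictToStrict as ToStrict
open import Relation.Binary.Structures using (IsTotalOrder)
open import Relation.Nullary using (¬_; yes; no)

private
  variable
    a c ℓ r r₁ r₂ : Level

-- The standard library only has Heyting fields.  Classically equality is
-- always decidable, so this is the textbook notion of a field.
record Field c ℓ : Set (lsuc (c ⊔ˡ ℓ)) where
  field
    commutativeRing : CommutativeRing c ℓ
  open CommutativeRing commutativeRing public
  open RawSemiringDefinitions (Semiring.rawSemiring semiring) public using (_^_; product; sum)
    renaming (_×_ to _·_)
  field
    _≟_        : Decidable _≈_
    0≉1        : 0# ≉ 1#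
    invertible : ∀ x → x ≉ 0# → ∃ λ y → y * x ≈ 1#

  infix  9 _⁻¹
  infixl 7 _/_

  -- Total, with 0⁻¹ = 0.
  _⁻¹ : Carrier → Carrier
  x ⁻¹ with x ≟ 0#
  ... | yes _   = 0#
  ... | no  x≉0 = proj₁ (invertible x x≉0)

  _/_ : Carrier → Carrier → Carrier
  x / y = x * y ⁻¹

-- Every monic polynomial Xⁿ⁺¹ + Σ_{i ≤ n} aᵢ Xⁱ has a root.
AlgebraicallyClosed : Field c ℓ → Set (c ⊔ˡ ℓ)
AlgebraicallyClosed K =
  ∀ n (as : Vector Carrier (suc n)) →
  ∃ λ x → x ^ suc n + sum (λ i → as i * x ^ toℕ i) ≈ 0#
  where open Field K

-- A Cauchy complete archimedean ordered field, which is classically unique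
-- up to unique isomorphism, together with its exponential and logarithm.
record RealNumbers r r₁ r₂ : Set (lsuc (r ⊔ˡ r₁ ⊔ˡ r₂)) where
  field
    realField : Field r r₁
  open Field realField public
  field
    _≤_          : Rel Carrier r₂
    isTotalOrder : IsTotalOrder _≈_ _≤_
    +-mono-≤     : ∀ {x y} z → x ≤ y → (x + z) ≤ (y + z)
    *-nonneg     : ∀ {x y} → 0# ≤ x → 0# ≤ y → 0# ≤ (x * y)

  infix 4 _≤_

  totalOrder : TotalOrder r r₁ r₂
  totalOrder = record { isTotalOrder = isTotalOrder }

  open Max totalOrder public using (_⊔_)
  open ToStrict _≈_ _≤_ public using (_<_)

  ∣_∣ᴿ : Carrier → Carrier
  ∣ x ∣ᴿ = x ⊔ - x

  ι : ℕ → Carrier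
  ι n = n · 1#

  ConvergesTo : (ℕ → Carrier) → Carrier → Set (r ⊔ˡ r₁ ⊔ˡ r₂)
  ConvergesTo s x =
    ∀ ε → 0# < ε → ∃ λ n₀ → ∀ n → n₀ ℕ.≤ n → ∣ s n - x ∣ᴿ < ε

  Cauchy : (ℕ → Carrier) → Set (r ⊔ˡ r₁ ⊔ˡ r₂)
  Cauchy s =
    ∀ ε → 0# < ε →
    ∃ λ n₀ → ∀ m n → n₀ ℕ.≤ m → n₀ ℕ.≤ n → ∣ s m - s n ∣ᴿ < ε

  field
    archimedean : ∀ x → ∃ λ n → x ≤ ι n
    complete    : ∀ s → Cauchy s → ∃ (ConvergesTo s)

  -- These laws determine exp: (1 + x/n)ⁿ ≤ exp (x/n)ⁿ = exp x for large n,
  -- and the same bound for exp (- x) = (exp x)⁻¹.  The value of log at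
  -- nonpositive arguments is unspecified.
  field
    exp      : Carrier → Carrier
    exp-cong : ∀ {x y} → x ≈ y → exp x ≈ exp y
    exp-+    : ∀ x y → exp (x + y) ≈ exp x * exp y
    1+x≤exp  : ∀ x → (1# + x) ≤ exp x
    log      : Carrier → Carrier
    log-cong : ∀ {x y} → x ≈ y → log x ≈ log y
    exp-log  : ∀ x → 0# < x → exp (log x) ≈ x

  infixr 8 _^ᴿ_

  -- Real powers of nonnegative reals with positive exponents; thus 0 ^ᴿ a = 0.
  _^ᴿ_ : Carrier → Carrier → Carrier
  x ^ᴿ a with x ≟ 0#
  ... | yes _ = 0#
  ... | no  _ = exp (a * log x)

  max : ∀ {n} → Vector Carrier n → Carrier
  max = Vec.foldr _⊔_ 0#

record NonarchimedeanAbsoluteValue (ℝ : RealNumbers r r₁ r₂) (K : Field c ℓ)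
       : Set (r ⊔ˡ r₁ ⊔ˡ r₂ ⊔ˡ c ⊔ˡ ℓ) where
  private
    module ℝ = RealNumbers ℝ
    module K = Field K
  open ℝ using (_≤_; _<_; _⊔_)
  field
    ∣_∣         : K.Carrier → ℝ.Carrier
    ∣∣-cong     : ∀ {x y} → x K.≈ y → ∣ x ∣ ℝ.≈ ∣ y ∣
    nonneg      : ∀ x → ℝ.0# ≤ ∣ x ∣
    zero⇔       : ∀ x → (∣ x ∣ ℝ.≈ ℝ.0#) ⇔ (x K.≈ K.0#)
    ∣∣-*        : ∀ x y → ∣ x K.* y ∣ ℝ.≈ ∣ x ∣ ℝ.* ∣ y ∣
    ultrametric : ∀ x y → ∣ x K.+ y ∣ ≤ (∣ x ∣ ⊔ ∣ y ∣)

  Nontrivial : Set (r₁ ⊔ˡ c ⊔ˡ ℓ)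
  Nontrivial = ∃ λ x → x K.≉ K.0# × ∣ x ∣ ℝ.≉ ℝ.1#

  Complete : Set (r ⊔ˡ r₁ ⊔ˡ r₂ ⊔ˡ c)
  Complete =
    ∀ (s : ℕ → K.Carrier) →
    (∀ ε → ℝ.0# < ε →
       ∃ λ n₀ → ∀ m n → n₀ ℕ.≤ m → n₀ ℕ.≤ n → ∣ s m K.- s n ∣ < ε) →
    ∃ λ x → ∀ ε → ℝ.0# < ε → ∃ λ n₀ → ∀ n → n₀ ℕ.≤ n → ∣ s n K.- x ∣ < ε

-- Monomials of degree d in X₀, …, Xₙ₋₁, each represented exactly once:
-- 1· m is m shifted to the variables X₁, …, Xₙ, and X₀· m is X₀ times m.
data Monomial : ℕ → ℕ → Set where
  []   : Monomial 0 0
  1·_  : ∀ {n d} → Monomial n d → Monomial (suc n) d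
  X₀·_ : ∀ {n d} → Monomial (suc n) d → Monomial (suc n) (suc d)

exponent : ∀ {n d} → Monomial n d → Fin n → ℕ
exponent (1· m)  zero    = 0
exponent (1· m)  (suc i) = exponent m i
exponent (X₀· m) zero    = suc (exponent m zero)
exponent (X₀· m) (suc i) = exponent m (suc i)

monomials : ∀ n d → List (Monomial n d)
monomials zero    zero    = [] ∷ []
monomials zero    (suc d) = []
monomials (suc n) zero    = List.map 1·_ (monomials n zero)
monomials (suc n) (suc d) =
  List.map 1·_ (monomials n (suc d)) ++ List.map X₀·_ (monomials (suc n) d)

-- Families of N + 1 forms of degree d in N + 1 variables, by coefficients.
Coefficient : ℕ → ℕ → Set
Coefficient N d = Fin (suc N) × Monomial (suc N) d

Forms : Set a → ℕ → ℕ → Set a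
Forms A N d = Coefficient N d → A

module _ (A : CommutativeRing c ℓ) where
  open CommutativeRing A
  open RawSemiringDefinitions (Semiring.rawSemiring semiring) using (_^_; product)

  evaluate : ∀ {N d} → Forms Carrier N d →
             Vector Carrier (suc N) → Vector Carrier (suc N)
  evaluate {N} {d} Φ x i =
    List.foldr _+_ 0#
      (List.map (λ m → Φ (i , m) * product (λ j → x j ^ exponent m j))
                (monomials (suc N) d))

module _ (K : Field c ℓ) where
  open Field K

  IsZero : ∀ {n} → Vector Carrier n → Set ℓ
  IsZero x = ∀ i → x i ≈ 0#

  HasNontrivialZero : ∀ {N d} → Forms Carrier N d → Set (c ⊔ˡ ℓ)
  HasNontrivialZero Φ =
    ∃ λ x → ¬ IsZero x × IsZero (evaluate commutativeRing Φ x)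

-- (X₀ᵈ, …, X_Nᵈ): a monomial of degree d is Xᵢᵈ iff its exponent at i is d.
powers : ∀ N d → Forms ℤ N d
powers N d (i , m) with exponent m i ℕ.≟ d
... | yes _ = 1ℤ
... | no  _ = 0ℤ

-- ℤ[V] as the free commutative ring on V.
data Polynomial (V : Set) : Set where
  var     : V → Polynomial V
  _⊕_ _⊛_ : Polynomial V → Polynomial V → Polynomial V
  ⊖_      : Polynomial V → Polynomial V
  𝟘 𝟙     : Polynomial V

infixl 6 _⊕_
infixl 7 _⊛_
infix  8 ⊖_
infix  4 _≃_

data _≃_ {V : Set} : Rel (Polynomial V) 0ℓ where
  refl       : ∀ {p} → p ≃ p
  sym        : ∀ {p q} → p ≃ q → q ≃ p
  trans      : ∀ {p q s} → p ≃ q → q ≃ s → p ≃ s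
  ⊕-cong     : ∀ {p p′ q q′} → p ≃ p′ → q ≃ q′ → p ⊕ q ≃ p′ ⊕ q′
  ⊛-cong     : ∀ {p p′ q q′} → p ≃ p′ → q ≃ q′ → p ⊛ q ≃ p′ ⊛ q′
  ⊖-cong     : ∀ {p p′} → p ≃ p′ → ⊖ p ≃ ⊖ p′
  ⊕-assoc    : ∀ p q s → (p ⊕ q) ⊕ s ≃ p ⊕ (q ⊕ s)
  ⊕-comm     : ∀ p q → p ⊕ q ≃ q ⊕ p
  ⊕-identity : ∀ p → 𝟘 ⊕ p ≃ p
  ⊕-inverse  : ∀ p → ⊖ p ⊕ p ≃ 𝟘
  ⊛-assoc    : ∀ p q s → (p ⊛ q) ⊛ s ≃ p ⊛ (q ⊛ s)
  ⊛-comm     : ∀ p q → p ⊛ q ≃ q ⊛ p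
  ⊛-identity : ∀ p → 𝟙 ⊛ p ≃ p
  ⊛-distribʳ : ∀ p q s → (q ⊕ s) ⊛ p ≃ (q ⊛ p) ⊕ (s ⊛ p)

ℤ[_] : Set → CommutativeRing 0ℓ 0ℓ
ℤ[ V ] = record
  { Carrier = Polynomial V ; _≈_ = _≃_
  ; _+_ = _⊕_ ; _*_ = _⊛_ ; -_ = ⊖_ ; 0# = 𝟘 ; 1# = 𝟙
  ; isCommutativeRing = record
    { isRing = record
      { +-isAbelianGroup = record
        { isGroup = record
          { isMonoid = record
            { isSemigroup = record
              { isMagma = record
                { isEquivalence = record { refl = refl ; sym = sym ; trans = trans }
                ; ∙-cong = ⊕-cong }
              ; assoc = ⊕-assoc }
            ; identity = ⊕-identity
                       , (λ p → trans (⊕-comm p 𝟘) (⊕-identity p)) }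
          ; inverse = ⊕-inverse
                    , (λ p → trans (⊕-comm p (⊖ p)) (⊕-inverse p))
          ; ⁻¹-cong = ⊖-cong }
        ; comm = ⊕-comm }
      ; *-cong = ⊛-cong
      ; *-assoc = ⊛-assoc
      ; *-identity = ⊛-identity
                   , (λ p → trans (⊛-comm p 𝟙) (⊛-identity p))
      ; distrib = (λ p q s → trans (⊛-comm p (q ⊕ s))
                      (trans (⊛-distribʳ p q s)
                             (⊕-cong (⊛-comm q p) (⊛-comm s p))))
                , ⊛-distribʳ }
    ; *-comm = ⊛-comm }
  }

specialise : (A : CommutativeRing c ℓ) → let open CommutativeRing A in
             ∀ {V} → (V → Carrier) → Polynomial V → Carrier
specialise A ρ = go
  where
  open CommutativeRing A
  go : Polynomial _ → Carrier
  go (var v) = ρ v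
  go (p ⊕ q) = go p + go q
  go (p ⊛ q) = go p * go q
  go (⊖ p)   = - go p
  go 𝟘       = 0#
  go 𝟙       = 1#

-- The multivariate (Macaulay) resultant of N + 1 forms of degree d in N + 1
-- variables is the unique irreducible polynomial over ℤ in their coefficients
-- that vanishes, over any algebraically closed field, exactly at the families
-- with a common nontrivial zero, and has value 1 at (X₀ᵈ, …, X_Nᵈ).
record IsMacaulayResultant c ℓ N d (Res : Polynomial (Coefficient N d))
       : Set (lsuc (c ⊔ˡ ℓ)) where
  field
    irreducible : RawSemiringDefinitions.Irreducible
                    (Semiring.rawSemiring (CommutativeRing.semiring ℤ[ Coefficient N d ])) Res
    normalised  : specialise ℤ.+-*-commutativeRing (powers N d) Res ≡ 1ℤ
    vanishing   : ∀ (K : Field c ℓ) → AlgebraicallyClosed K →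
                  let open Field K in
                  ∀ (Φ : Forms Carrier N d) →
                  (specialise commutativeRing Φ Res ≈ 0#) ⇔ HasNontrivialZero K Φ

module Projective (K : Field c ℓ) (N : ℕ) where
  open Field K
  open import Relation.Binary.Reasoning.Setoid setoid

  Point : Set (c ⊔ˡ ℓ)
  Point = Σ (Vector Carrier (suc N)) λ x → ¬ IsZero K x

  infix 4 _∼_

  _∼_ : Rel Point (c ⊔ˡ ℓ)
  (x , _) ∼ (y , _) = ∃ λ k → k ≉ 0# × ∀ i → x i ≈ k * y i

  private
    cancel : ∀ {k k′ x y} → k′ * k ≈ 1# → x ≈ k * y → k′ * x ≈ y
    cancel {k} {k′} {x} {y} k′k≈1 x≈ky = begin
      k′ * x        ≈⟨ *-congˡ x≈ky ⟩
      k′ * (k * y)  ≈⟨ *-assoc k′ k y ⟨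
      k′ * k * y    ≈⟨ *-congʳ k′k≈1 ⟩
      1# * y        ≈⟨ *-identityˡ y ⟩
      y             ∎

    ∼-refl : ∀ {P} → P ∼ P
    ∼-refl = 1# , (λ 1≈0 → 0≉1 (Field.sym K 1≈0)) , λ i → Field.sym K (*-identityˡ _)

    ∼-sym : ∀ {P Q} → P ∼ Q → Q ∼ P
    ∼-sym (k , k≉0 , x≈ky) with invertible k k≉0
    ... | k′ , k′k≈1 = k′ , k′≉0 , λ i → Field.sym K (cancel k′k≈1 (x≈ky i))
      where
      k′≉0 : k′ ≉ 0#
      k′≉0 k′≈0 = 0≉1 (begin
        0#      ≈⟨ zeroˡ k ⟨
        0# * k  ≈⟨ *-congʳ k′≈0 ⟨
        k′ * k  ≈⟨ k′k≈1 ⟩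
        1#      ∎)

    ∼-trans : ∀ {P Q S} → P ∼ Q → Q ∼ S → P ∼ S
    ∼-trans {_} {_} {z , _} (k , k≉0 , x≈ky) (l , l≉0 , y≈lz) =
      k * l , kl≉0 , λ i → begin
        _              ≈⟨ x≈ky i ⟩
        k * _          ≈⟨ *-congˡ (y≈lz i) ⟩
        k * (l * z i)  ≈⟨ *-assoc k l (z i) ⟨
        k * l * z i    ∎
      where
      kl≉0 : k * l ≉ 0#
      kl≉0 kl≈0 with invertible k k≉0
      ... | k′ , k′k≈1 = l≉0 (begin
        l        ≈⟨ cancel k′k≈1 (Field.sym K kl≈0) ⟨
        k′ * 0#  ≈⟨ zeroʳ k′ ⟩
        0#       ∎)

  ℙ : Setoid (c ⊔ˡ ℓ) (c ⊔ˡ ℓ)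
  ℙ = record
    { Carrier = Point ; _≈_ = _∼_
    ; isEquivalence = record
      { refl  = λ {P} → ∼-refl {P}
      ; sym   = λ {P} {Q} → ∼-sym {P} {Q}
      ; trans = λ {P} {Q} {S} → ∼-trans {P} {Q} {S} } }

  π : (x : Vector Carrier (suc N)) → ¬ IsZero K x → Point
  π = _,_

  -- A self-map of ℙ having a lift of degree d is a morphism of degree d, and
  -- conversely.
  record IsLift {d} (φ : Func ℙ ℙ) (Φ : Forms Carrier N d) : Set (c ⊔ˡ ℓ) where
    ⟦Φ⟧ : Vector Carrier (suc N) → Vector Carrier (suc N)
    ⟦Φ⟧ = evaluate commutativeRing Φ
    field
      noNontrivialZero : ¬ HasNontrivialZero K Φ

    nonzero : ∀ {x} → ¬ IsZero K x → ¬ IsZero K (⟦Φ⟧ x)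
    nonzero x≢0 Φx≡0 = noNontrivialZero (_ , x≢0 , Φx≡0)

    field
      commutes : ∀ x (x≢0 : ¬ IsZero K x) →
                 Func.to φ (π x x≢0) ∼ π (⟦Φ⟧ x) (nonzero x≢0)

module Dynamics {ℝ : RealNumbers r r₁ r₂} {K : Field c ℓ}
                (v : NonarchimedeanAbsoluteValue ℝ K) (N : ℕ) where
  private
    module ℝ = RealNumbers ℝ
    module K = Field K
  open ℝ using (_≤_; _<_; _⊔_; _*_; _/_; _-_; _^_; _^ᴿ_; ∣_∣ᴿ; ι; log; max; 0#; 1#)
  open NonarchimedeanAbsoluteValue v using (∣_∣)
  open Projective K N public

  ‖_‖ : ∀ {n} → Vector K.Carrier n → ℝ.Carrier
  ‖ x ‖ = max (∣_∣ ∘ x)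

  Δ : Point → Point → ℝ.Carrier
  Δ (x , _) (y , _) =
    max (λ i → max λ j → ∣ x i K.* y j K.- x j K.* y i ∣) / (‖ x ‖ * ‖ y ‖)

  ‖_‖ᶠ : ∀ {d} → Forms K.Carrier N d → ℝ.Carrier
  ‖_‖ᶠ {d} Φ =
    max λ i → List.foldr _⊔_ 0# (List.map (λ m → ∣ Φ (i , m) ∣) (monomials (suc N) d))

  Minimal : ∀ {d} → Forms K.Carrier N d → Set r₁
  Minimal Φ = ‖ Φ ‖ᶠ ℝ.≈ 1#

  IsGreenFunction : ∀ {d} → Forms K.Carrier N d →
                    (Vector K.Carrier (suc N) → ℝ.Carrier) →
                    Set (r ⊔ˡ r₁ ⊔ˡ r₂ ⊔ˡ c ⊔ˡ ℓ)
  IsGreenFunction {d} Φ G =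
    ∀ x → ¬ IsZero K x →
    ℝ.ConvergesTo
      (λ n → log ‖ fold x (evaluate K.commutativeRing Φ) n ‖ / ι d ^ n) (G x)

  modified : (Vector K.Carrier (suc N) → ℝ.Carrier) → Point → ℝ.Carrier
  modified G (x , _) = G x - log ‖ x ‖

  HölderContinuous : (Point → ℝ.Carrier) → Set (r ⊔ˡ r₁ ⊔ˡ r₂ ⊔ˡ c ⊔ˡ ℓ)
  HölderContinuous g =
    ∃ λ C → ∃ λ α → 0# < C × 0# < α × α ≤ 1# ×
    (∀ P Q → ∣ g P - g Q ∣ᴿ ≤ C * Δ P Q ^ᴿ α)

-- Let Ψ be minimal and R = |Res φ|.  If ‖x‖ = |xᵢ|, subtracting from each Ψⱼ the
-- multiple Ψⱼ(x) / xᵢᵈ of Xᵢᵈ gives forms vanishing at x, hence with resultant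
-- zero; as the resultant is an integral polynomial in the coefficients, this
-- yields R ‖x‖ᵈ ≤ ‖Ψ(x)‖ ≤ ‖x‖ᵈ.  Together with
-- |yᵢᵈ Ψⱼ(x) − xᵢᵈ Ψⱼ(y)| ≤ Δ(x, y) (‖x‖ ‖y‖)ᵈ it follows that ‖Ψ(x)‖/‖x‖ᵈ takes
-- equal values at points closer than R and that φ expands Δ by at most R⁻².  The
-- same holds for Φ up to a constant factor, because Φ = κ Ψ.  So, as long as the
-- orbits of P and Q stay closer than R, each application of φ multiplies the
-- difference of ĝ by d and the distance by at most u; and d |ĝ(P) − ĝ(Q)| is never
-- larger than −2 log R.
module Submission where

open import Defs hiding (refl; sym; trans)
open import Algebra.Bundles using (CommutativeRing)
import Algebra.Construct.NaturalChoice.Max as Max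
import Algebra.Properties.AbelianGroup as AbelianGroupProperties
import Algebra.Properties.CommutativeSemiring.Exp as Exp
import Algebra.Properties.Ring as RingProperties
import Algebra.Properties.Semiring.Mult.TCOptimised as Mult
import Algebra.Solver.Ring as RingSolver
open import Algebra.Solver.Ring.AlmostCommutativeRing
  using (AlmostCommutativeRing; fromCommutativeRing; _-Raw-AlmostCommutative⟶_)
open import Data.Fin.Base using (Fin; zero; suc)
import Data.Fin.Properties as Fin
open import Data.Integer.Base as ℤ using (ℤ; +_; -[1+_]; _⊖_)
import Data.Integer.Properties as ℤ
open import Data.List.Base as List using (List; []; _∷_; _++_; length; filter)
open import Data.List.Membership.Propositional using (_∈_)
open import Data.List.Membership.Propositional.Properties using (∈-map⁺; ∈-++⁺ˡ; ∈-++⁺ʳ)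
import Data.List.Properties as List
open import Data.List.Relation.Unary.All as All using (All; []; _∷_)
import Data.List.Relation.Unary.All.Properties as All
open import Data.List.Relation.Unary.AllPairs using (AllPairs; []; _∷_)
import Data.List.Relation.Unary.AllPairs.Properties as AllPairs
open import Data.List.Relation.Unary.Any using (here; there)
open import Data.Maybe.Base as Maybe using (Maybe)
open import Data.Nat.Base as ℕ using (ℕ; zero; suc; z≤n; s≤s)
open import Data.Nat.GeneralisedArithmetic using (fold)
import Data.Nat.Properties as ℕ
open import Data.Product.Base using (∃; _×_; _,_; proj₁; proj₂)
open import Data.Sum.Base using (_⊎_; inj₁; inj₂)
open import Data.Vec.Functional using (Vector)
open import Function.Base using (_∘_)
open import Function.Bundles using (Equivalence; Func; _⇔_)
open import Level using (Level) renaming (_⊔_ to _⊔ˡ_)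
open import Relation.Binary.Bundles using (DecTotalOrder; Setoid; TotalOrder)
import Relation.Binary.Properties.TotalOrder as TotalOrderProperties
open import Relation.Binary.PropositionalEquality.Core as ≡ using (_≡_)
import Relation.Binary.Reasoning.PartialOrder as PartialOrderReasoning
import Relation.Binary.Reasoning.Setoid as SetoidReasoning
open import Relation.Nullary using (Dec; ¬_; yes; no; contradiction)
open import Relation.Nullary.Decidable using (dec⇒maybe; decidable-stable)
open import Relation.Unary using (Pred; Decidable)
open import Relation.Unary.Properties using (∁?)

-- Being lifts of the same map only makes Φ(x) and Ψ(x) proportional for each x, by a scalar that
-- may vary with x. That a single κ serves all x is the main algebraic obstacle; finiteness of the
-- possible scalars, read off from the resultant, replaces an argument with coprime polynomials.
--
-- The constants arise as follows. Along the orbits each application of φ contributes at most -log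
-- R, weighted by powers of 1/d, so d |ĝ(P) - ĝ(Q)| is at most d/(d - 1) times -log R. As d ≥ 2 this
-- gives the factor 2. The exponent α solves u^α = d, so C ε^α grows by d when ε grows by u, in step
-- with the difference of ĝ. When ε ≥ R the bound has to hold outright: then uε ≥ 1, so u ε^α ≥ d
-- ε^α = (uε)^α ≥ 1, and with -log R ≤ log u this makes C = 2u log u / d large enough.
--
-- Distance zero never grows to R. There dⁿ |ĝ(P) - ĝ(Q)| stays bounded for all n, which forces the
-- difference to vanish.

-- Ring identities with integer coefficients

-- The library's ring solver needs coefficients with computing equality.
module IntegerSolver {c ℓ : Level} (R : CommutativeRing c ℓ) where
  open CommutativeRing R
  open RingProperties ring
  open AbelianGroupProperties +-abelianGroup using (⁻¹-∙-comm)
  open Mult semiring using (1+×; ×-homo-+; ×1-homo-*) renaming (_×_ to _·_)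
  open SetoidReasoning setoid

  private
    -- The optimised multiple 1 · 1# is 1# by computation.
    ⟦_⟧ : ℤ → Carrier
    ⟦ + n ⟧      = n · 1#
    ⟦ -[1+ n ] ⟧ = - (suc n · 1#)

    cancel-suc : ∀ x y z → (z + x) + - (z + y) ≈ x + - y
    cancel-suc x y z = begin
      (z + x) + - (z + y)    ≈⟨ +-cong (+-comm z x) (sym (⁻¹-∙-comm z y)) ⟩
      (x + z) + (- z + - y)  ≈⟨ +-assoc x z _ ⟩
      x + (z + (- z + - y))  ≈⟨ +-congˡ (sym (+-assoc z (- z) (- y))) ⟩
      x + (z + - z + - y)    ≈⟨ +-congˡ (+-congʳ (-‿inverseʳ z)) ⟩
      x + (0# + - y)         ≈⟨ +-congˡ (+-identityˡ (- y)) ⟩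
      x + - y                ∎

    ⊖-homo : ∀ m n → ⟦ m ⊖ n ⟧ ≈ m · 1# + - (n · 1#)
    ⊖-homo zero    zero    = sym (-‿inverseʳ 0#)
    ⊖-homo zero    (suc n) = sym (+-identityˡ _)
    ⊖-homo (suc m) zero    = sym (trans (+-congˡ -0#≈0#) (+-identityʳ _))
    ⊖-homo (suc m) (suc n) = begin
      ⟦ suc m ⊖ suc n ⟧                ≡⟨ ≡.cong ⟦_⟧ (ℤ.[1+m]⊖[1+n]≡m⊖n m n) ⟩
      ⟦ m ⊖ n ⟧                        ≈⟨ ⊖-homo m n ⟩
      m · 1# + - (n · 1#)              ≈⟨ cancel-suc _ _ 1# ⟨
      (1# + m · 1#) + - (1# + n · 1#)  ≈⟨ +-cong (1+× m 1#) (-‿cong (1+× n 1#)) ⟨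
      suc m · 1# + - (suc n · 1#)      ∎

    +-homo : ∀ i j → ⟦ i ℤ.+ j ⟧ ≈ ⟦ i ⟧ + ⟦ j ⟧
    +-homo (+ m)    (+ n)    = ×-homo-+ 1# m n
    +-homo (+ m)    -[1+ n ] = ⊖-homo m (suc n)
    +-homo -[1+ m ] (+ n)    = trans (⊖-homo n (suc m)) (+-comm _ _)
    +-homo -[1+ m ] -[1+ n ] = begin
      - (suc (suc (m ℕ.+ n)) · 1#)             ≡⟨ ≡.cong (λ k → - (suc k · 1#)) (≡.sym (ℕ-+-suc m n)) ⟩
      - ((suc m ℕ.+ suc n) · 1#)               ≈⟨ -‿cong (×-homo-+ 1# (suc m) (suc n)) ⟩
      - (suc m · 1# + suc n · 1#)              ≈⟨ ⁻¹-∙-comm _ _ ⟨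
      - (suc m · 1#) + - (suc n · 1#)          ∎
      where open import Data.Nat.Properties using () renaming (+-suc to ℕ-+-suc)

    -‿homo : ∀ i → ⟦ ℤ.- i ⟧ ≈ - ⟦ i ⟧
    -‿homo (+ zero)  = sym -0#≈0#
    -‿homo (+ suc n) = refl
    -‿homo -[1+ n ]  = sym (-‿involutive _)

    *-homo-+ : ∀ m j → ⟦ + m ℤ.* j ⟧ ≈ m · 1# * ⟦ j ⟧
    *-homo-+ m (+ n)    = begin
      ⟦ + m ℤ.* + n ⟧    ≡⟨ ≡.cong ⟦_⟧ (ℤ.pos-* m n) ⟨
      (m ℕ.* n) · 1#     ≈⟨ ×1-homo-* m n ⟩
      m · 1# * n · 1#    ∎
    *-homo-+ m -[1+ n ] = begin
      ⟦ + m ℤ.* -[1+ n ] ⟧         ≡⟨ ≡.cong ⟦_⟧ (ℤ.neg-distribʳ-* (+ m) (+ suc n)) ⟨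
      ⟦ ℤ.- (+ m ℤ.* + suc n) ⟧    ≈⟨ -‿homo (+ m ℤ.* + suc n) ⟩
      - ⟦ + m ℤ.* + suc n ⟧        ≈⟨ -‿cong (*-homo-+ m (+ suc n)) ⟩
      - (m · 1# * suc n · 1#)      ≈⟨ -‿distribʳ-* _ _ ⟩
      m · 1# * - (suc n · 1#)      ∎

    *-homo : ∀ i j → ⟦ i ℤ.* j ⟧ ≈ ⟦ i ⟧ * ⟦ j ⟧
    *-homo (+ m)    j = *-homo-+ m j
    *-homo -[1+ m ] j = begin
      ⟦ -[1+ m ] ℤ.* j ⟧        ≡⟨ ≡.cong ⟦_⟧ (ℤ.neg-distribˡ-* (+ suc m) j) ⟨
      ⟦ ℤ.- (+ suc m ℤ.* j) ⟧   ≈⟨ -‿homo (+ suc m ℤ.* j) ⟩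
      - ⟦ + suc m ℤ.* j ⟧       ≈⟨ -‿cong (*-homo-+ (suc m) j) ⟩
      - (suc m · 1# * ⟦ j ⟧)    ≈⟨ -‿distribˡ-* _ _ ⟩
      - (suc m · 1#) * ⟦ j ⟧    ∎

    target : AlmostCommutativeRing c ℓ
    target = fromCommutativeRing R

    morphism : ℤ.+-*-rawRing -Raw-AlmostCommutative⟶ target
    morphism = record
      { ⟦_⟧ = ⟦_⟧ ; +-homo = +-homo ; *-homo = *-homo ; -‿homo = -‿homo
      ; 0-homo = refl ; 1-homo = refl }

    _coeff≟_ : ∀ i j → Maybe (⟦ i ⟧ ≈ ⟦ j ⟧)
    i coeff≟ j = Maybe.map (λ i≡j → reflexive (≡.cong ⟦_⟧ i≡j)) (dec⇒maybe (i ℤ.≟ j))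

  open RingSolver ℤ.+-*-rawRing target morphism _coeff≟_ public
    using (solve; _:=_; _:+_; _:*_; _:-_; :-_; con)

-- Fields and inverses

module FieldProperties {c ℓ : Level} (K : Field c ℓ) where
  open Field K hiding (zero)
  open IntegerSolver commutativeRing
  open SetoidReasoning setoid

  ⁻¹-inverseˡ : ∀ {x} → x ≉ 0# → x ⁻¹ * x ≈ 1#
  ⁻¹-inverseˡ {x} x≉0 with x ≟ 0#
  ... | yes x≈0  = contradiction x≈0 x≉0
  ... | no  x≉0′ = proj₂ (invertible x x≉0′)

  ⁻¹-inverseʳ : ∀ {x} → x ≉ 0# → x * x ⁻¹ ≈ 1#
  ⁻¹-inverseʳ x≉0 = trans (*-comm _ _) (⁻¹-inverseˡ x≉0)

  1≉0 : 1# ≉ 0#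
  1≉0 = 0≉1 ∘ sym

  /-cancel : ∀ {x y} → y ≉ 0# → x / y * y ≈ x
  /-cancel y≉0 = trans (*-assoc _ _ _) (trans (*-congˡ (⁻¹-inverseˡ y≉0)) (*-identityʳ _))

  *-cancelˡ : ∀ {x y z} → x ≉ 0# → x * y ≈ x * z → y ≈ z
  *-cancelˡ {x} {y} {z} x≉0 xy≈xz = begin
    y             ≈⟨ *-identityˡ y ⟨
    1# * y        ≈⟨ *-congʳ (⁻¹-inverseˡ x≉0) ⟨
    x ⁻¹ * x * y  ≈⟨ *-assoc _ x y ⟩
    x ⁻¹ * (x * y) ≈⟨ *-congˡ xy≈xz ⟩
    x ⁻¹ * (x * z) ≈⟨ *-assoc _ x z ⟨
    x ⁻¹ * x * z  ≈⟨ *-congʳ (⁻¹-inverseˡ x≉0) ⟩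
    1# * z        ≈⟨ *-identityˡ z ⟩
    z             ∎

  x≉0∧xy≈0⇒y≈0 : ∀ {x y} → x ≉ 0# → x * y ≈ 0# → y ≈ 0#
  x≉0∧xy≈0⇒y≈0 x≉0 xy≈0 = *-cancelˡ x≉0 (trans xy≈0 (sym (zeroʳ _)))

  *-≉0 : ∀ {x y} → x ≉ 0# → y ≉ 0# → x * y ≉ 0#
  *-≉0 x≉0 y≉0 = y≉0 ∘ x≉0∧xy≈0⇒y≈0 x≉0

  ⁻¹-≉0 : ∀ {x} → x ≉ 0# → x ⁻¹ ≉ 0#
  ⁻¹-≉0 x≉0 x⁻¹≈0 = 1≉0 (trans (sym (⁻¹-inverseʳ x≉0)) (trans (*-congˡ x⁻¹≈0) (zeroʳ _)))

  -- `invertible` may choose different witnesses for equal elements, so congruence rests on the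
  -- uniqueness of inverses.
  ⁻¹-cong : ∀ {x y} → x ≈ y → x ⁻¹ ≈ y ⁻¹
  ⁻¹-cong {x} {y} x≈y with x ≟ 0# | y ≟ 0#
  ... | yes _   | yes _   = refl
  ... | yes x≈0 | no  y≉0 = contradiction (trans (sym x≈y) x≈0) y≉0
  ... | no  x≉0 | yes y≈0 = contradiction (trans x≈y y≈0) x≉0
  ... | no  x≉0 | no  y≉0 = *-cancelˡ x≉0 (begin
    x * proj₁ (invertible x x≉0)  ≈⟨ *-comm x _ ⟩
    proj₁ (invertible x x≉0) * x  ≈⟨ proj₂ (invertible x x≉0) ⟩
    1#                            ≈⟨ proj₂ (invertible y y≉0) ⟨
    proj₁ (invertible y y≉0) * y  ≈⟨ *-comm _ y ⟩
    y * proj₁ (invertible y y≉0)  ≈⟨ *-congʳ x≈y ⟨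
    x * proj₁ (invertible y y≉0)  ∎)

  x-y≈0⇒x≈y : ∀ {x y} → x - y ≈ 0# → x ≈ y
  x-y≈0⇒x≈y {x} {y} x-y≈0 = begin
    x            ≈⟨ solve 2 (λ x y → x := (x :- y) :+ y) refl x y ⟩
    (x - y) + y  ≈⟨ +-congʳ x-y≈0 ⟩
    0# + y       ≈⟨ +-identityˡ y ⟩
    y            ∎

-- Ordered field arithmetic, finite maxima and the archimedean property

module RealProperties {r r₁ r₂ : Level} (ℝ : RealNumbers r r₁ r₂) where
  open RealNumbers ℝ hiding (zero)
  open FieldProperties realField public
  open IntegerSolver commutativeRing public
  open Max totalOrder public using (x≤x⊔y; x≤y⊔x; ⊔-lub; ⊔-sel; ⊔-cong)
  open TotalOrder totalOrder public
    using (poset; antisym; total; ≤-respˡ-≈; ≤-respʳ-≈)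
    renaming (refl to ≤-refl; reflexive to ≤-reflexive; trans to ≤-trans)
  open TotalOrderProperties totalOrder public using (<-irrefl; <-trans; <⇒≱; ≰⇒>; decTotalOrder)
  open Exp commutativeSemiring public using (^-distrib-*; ^-congˡ)
  module ≤-Reasoning = PartialOrderReasoning poset
  open ≤-Reasoning

  open DecTotalOrder (decTotalOrder _≟_) public using (_≤?_)

  x≤y⊎y<x : ∀ x y → x ≤ y ⊎ y < x
  x≤y⊎y<x x y with x ≤? y
  ... | yes x≤y = inj₁ x≤y
  ... | no  x≰y = inj₂ (≰⇒> x≰y)

  -- Reduces an inequality to a nonnegative quantity and a ring identity for the difference of the
  -- two sides, which the solver can check.
  ≤-by : ∀ {x y z} → 0# ≤ z → z ≈ y - x → x ≤ y
  ≤-by {x} {y} {z} 0≤z z≈y-x = begin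
    x            ≈⟨ +-identityˡ x ⟨
    0# + x       ≤⟨ +-mono-≤ x 0≤z ⟩
    z + x        ≈⟨ +-congʳ z≈y-x ⟩
    (y - x) + x  ≈⟨ solve 2 (λ x y → (y :- x) :+ x := y) refl x y ⟩
    y            ∎

  x≤y⇒0≤y-x : ∀ {x y} → x ≤ y → 0# ≤ y - x
  x≤y⇒0≤y-x {x} x≤y = ≤-respˡ-≈ (-‿inverseʳ x) (+-mono-≤ (- x) x≤y)

  0≤y-x⇒x≤y : ∀ {x y} → 0# ≤ y - x → x ≤ y
  0≤y-x⇒x≤y 0≤y-x = ≤-by 0≤y-x refl

  +-nonneg : ∀ {x y} → 0# ≤ x → 0# ≤ y → 0# ≤ x + y
  +-nonneg {x} {y} 0≤x 0≤y = begin
    0#      ≤⟨ 0≤y ⟩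
    y       ≈⟨ +-identityˡ y ⟨
    0# + y  ≤⟨ +-mono-≤ y 0≤x ⟩
    x + y   ∎

  +-mono₂-≤ : ∀ {w x y z} → w ≤ x → y ≤ z → w + y ≤ x + z
  +-mono₂-≤ {w} {x} {y} {z} w≤x y≤z =
    ≤-by (+-nonneg (x≤y⇒0≤y-x w≤x) (x≤y⇒0≤y-x y≤z))
         (solve 4 (λ w x y z → (x :- w) :+ (z :- y) := (x :+ z) :- (w :+ y)) refl w x y z)

  -‿anti-≤ : ∀ {x y} → x ≤ y → - y ≤ - x
  -‿anti-≤ {x} {y} x≤y =
    ≤-by (x≤y⇒0≤y-x x≤y) (solve 2 (λ x y → y :- x := :- x :- (:- y)) refl x y)

  *-monoʳ-≤ : ∀ {x y z} → 0# ≤ z → x ≤ y → z * x ≤ z * y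
  *-monoʳ-≤ {x} {y} {z} 0≤z x≤y =
    ≤-by (*-nonneg 0≤z (x≤y⇒0≤y-x x≤y))
         (solve 3 (λ x y z → z :* (y :- x) := z :* y :- z :* x) refl x y z)

  *-monoˡ-≤ : ∀ {x y z} → 0# ≤ z → x ≤ y → x * z ≤ y * z
  *-monoˡ-≤ 0≤z x≤y =
    ≤-respˡ-≈ (*-comm _ _) (≤-respʳ-≈ (*-comm _ _) (*-monoʳ-≤ 0≤z x≤y))

  *-mono₂-≤ : ∀ {w x y z} → 0# ≤ w → 0# ≤ z → w ≤ x → y ≤ z → w * y ≤ x * z
  *-mono₂-≤ 0≤w 0≤z w≤x y≤z = ≤-trans (*-monoʳ-≤ 0≤w y≤z) (*-monoˡ-≤ 0≤z w≤x)

  0<⇒≉0 : ∀ {x} → 0# < x → x ≉ 0#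
  0<⇒≉0 (_ , 0≉x) = 0≉x ∘ sym

  ≉0⇒0< : ∀ {x} → 0# ≤ x → x ≉ 0# → 0# < x
  ≉0⇒0< 0≤x x≉0 = 0≤x , x≉0 ∘ sym

  *-positive : ∀ {x y} → 0# < x → 0# < y → 0# < x * y
  *-positive 0<x 0<y =
    ≉0⇒0< (*-nonneg (proj₁ 0<x) (proj₁ 0<y)) (*-≉0 (0<⇒≉0 0<x) (0<⇒≉0 0<y))

  0≤1 : 0# ≤ 1#
  0≤1 with total 0# 1#
  ... | inj₁ 0≤1 = 0≤1
  ... | inj₂ 1≤0 = ≤-respʳ-≈ (solve 0 (:- con (+ 1) :* :- con (+ 1) := con (+ 1)) refl) (*-nonneg 0≤-1 0≤-1)
    where
    0≤-1 : 0# ≤ - 1#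
    0≤-1 = ≤-respʳ-≈ (+-identityˡ (- 1#)) (x≤y⇒0≤y-x 1≤0)

  0<1 : 0# < 1#
  0<1 = 0≤1 , 0≉1

  <-≤-trans : ∀ {x y z} → x < y → y ≤ z → x < z
  <-≤-trans {x} {y} {z} x<y y≤z = begin-strict
    x  <⟨ x<y ⟩
    y  ≤⟨ y≤z ⟩
    z  ∎

  ≤-<-trans : ∀ {x y z} → x ≤ y → y < z → x < z
  ≤-<-trans {x} {y} {z} x≤y y<z = begin-strict
    x  ≤⟨ x≤y ⟩
    y  <⟨ y<z ⟩
    z  ∎

  +-positive : ∀ {x y} → 0# < x → 0# ≤ y → 0# < x + y
  +-positive {x} {y} 0<x 0≤y = <-≤-trans 0<x (≤-by 0≤y (solve 2 (λ x y → y := (x :+ y) :- x) refl x y))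

  x<y⇒0<y-x : ∀ {x y} → x < y → 0# < y - x
  x<y⇒0<y-x (x≤y , x≉y) = ≉0⇒0< (x≤y⇒0≤y-x x≤y) (x≉y ∘ sym ∘ x-y≈0⇒x≈y)

  0<y-x⇒x<y : ∀ {x y} → 0# < y - x → x < y
  0<y-x⇒x<y {x} {y} (0≤y-x , 0≉y-x) =
    0≤y-x⇒x≤y 0≤y-x , λ x≈y → 0≉y-x (sym (trans (+-congʳ (sym x≈y)) (-‿inverseʳ x)))

  *-monoʳ-< : ∀ {x y z} → 0# < z → x < y → z * x < z * y
  *-monoʳ-< 0<z (x≤y , x≉y) =
    *-monoʳ-≤ (proj₁ 0<z) x≤y , x≉y ∘ *-cancelˡ (0<⇒≉0 0<z)

  *-cancelˡ-≤ : ∀ {x y z} → 0# < z → z * x ≤ z * y → x ≤ y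
  *-cancelˡ-≤ {x} {y} 0<z zx≤zy with x≤y⊎y<x x y
  ... | inj₁ x≤y = x≤y
  ... | inj₂ y<x = contradiction zx≤zy (<⇒≱ (*-monoʳ-< 0<z y<x))

  ⁻¹-positive : ∀ {x} → 0# < x → 0# < x ⁻¹
  ⁻¹-positive {x} 0<x = ≉0⇒0< 0≤x⁻¹ (⁻¹-≉0 (0<⇒≉0 0<x))
    where
    0≤x⁻¹ : 0# ≤ x ⁻¹
    0≤x⁻¹ = *-cancelˡ-≤ 0<x (begin
      x * 0#      ≈⟨ zeroʳ x ⟩
      0#          ≤⟨ 0≤1 ⟩
      1#          ≈⟨ ⁻¹-inverseʳ (0<⇒≉0 0<x) ⟨
      x * x ⁻¹    ∎)

  /-positive : ∀ {x y} → 0# < x → 0# < y → 0# < x / y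
  /-positive 0<x 0<y = *-positive 0<x (⁻¹-positive 0<y)

  ≤-/ : ∀ {x y z} → 0# < z → z * x ≤ y → x ≤ y / z
  ≤-/ {x} {y} {z} 0<z zx≤y = *-cancelˡ-≤ 0<z (begin
    z * x        ≤⟨ zx≤y ⟩
    y            ≈⟨ /-cancel (0<⇒≉0 0<z) ⟨
    y / z * z    ≈⟨ *-comm _ z ⟩
    z * (y / z)  ∎)

  /-≤ : ∀ {x y z} → 0# < z → x ≤ y * z → x / z ≤ y
  /-≤ {x} {y} {z} 0<z x≤yz = *-cancelˡ-≤ 0<z (begin
    z * (x / z)  ≈⟨ *-comm z _ ⟩
    x / z * z    ≈⟨ /-cancel (0<⇒≉0 0<z) ⟩
    x            ≤⟨ x≤yz ⟩
    y * z        ≈⟨ *-comm y z ⟩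
    z * y        ∎)

  ^-nonneg : ∀ {x} n → 0# ≤ x → 0# ≤ x ^ n
  ^-nonneg zero    0≤x = 0≤1
  ^-nonneg (suc n) 0≤x = *-nonneg 0≤x (^-nonneg n 0≤x)

  ^-positive : ∀ {x} n → 0# < x → 0# < x ^ n
  ^-positive zero    0<x = 0<1
  ^-positive (suc n) 0<x = *-positive 0<x (^-positive n 0<x)

  ^-mono-≤ : ∀ {x y} n → 0# ≤ x → x ≤ y → x ^ n ≤ y ^ n
  ^-mono-≤ zero    0≤x x≤y = ≤-refl
  ^-mono-≤ (suc n) 0≤x x≤y =
    *-mono₂-≤ 0≤x (^-nonneg n (≤-trans 0≤x x≤y)) x≤y (^-mono-≤ n 0≤x x≤y)

  1≤^ : ∀ {x} n → 1# ≤ x → 1# ≤ x ^ n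
  1≤^ zero    1≤x = ≤-refl
  1≤^ {x} (suc n) 1≤x = begin
    1#       ≈⟨ *-identityˡ 1# ⟨
    1# * 1#  ≤⟨ *-mono₂-≤ 0≤1 (^-nonneg n (≤-trans 0≤1 1≤x)) 1≤x (1≤^ n 1≤x) ⟩
    x * x ^ n  ∎

  ^-<-^suc : ∀ {x} n → 1# < x → x ^ n < x ^ suc n
  ^-<-^suc {x} n 1<x = begin-strict
    x ^ n       ≈⟨ *-identityʳ _ ⟨
    x ^ n * 1#  <⟨ *-monoʳ-< (^-positive n (<-trans 0<1 1<x)) 1<x ⟩
    x ^ n * x   ≈⟨ *-comm _ x ⟩
    x ^ suc n   ∎

  ^-mono-< : ∀ {x m n} → 1# < x → m ℕ.< n → x ^ m < x ^ n
  ^-mono-< {x} {m} {suc n} 1<x (s≤s m≤n) with ℕ.m≤n⇒m<n∨m≡n m≤n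
  ... | inj₁ m<n    = <-trans (^-mono-< 1<x m<n) (^-<-^suc n 1<x)
  ... | inj₂ ≡.refl = ^-<-^suc n 1<x

  ι-nonneg : ∀ n → 0# ≤ ι n
  ι-nonneg zero    = ≤-refl
  ι-nonneg (suc n) = +-nonneg 0≤1 (ι-nonneg n)

  ι-positive : ∀ n → 0# < ι (suc n)
  ι-positive n = +-positive 0<1 (ι-nonneg n)

  ι-mono-≤ : ∀ {m n} → m ℕ.≤ n → ι m ≤ ι n
  ι-mono-≤ {n = n} z≤n   = ι-nonneg n
  ι-mono-≤ (s≤s m≤n) = +-mono₂-≤ ≤-refl (ι-mono-≤ m≤n)

  ι2≈1+1 : ι 2 ≈ 1# + 1#
  ι2≈1+1 = +-congˡ (+-identityʳ 1#)

  -- Converts archimedean bounds by natural numbers into bounds by powers, both for powers of d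
  -- multiplying a difference of ĝ and for powers of `u` multiplying a distance.
  ι≤^ : ∀ {x} n → ι 2 ≤ x → ι n ≤ x ^ n
  ι≤^ {x} n 2≤x = ≤-trans (≤-by 0≤1 (solve 1 (λ i → con (+ 1) := (con (+ 1) :+ i) :- i) refl (ι n))) (1+ι≤^ n)
    where
    1≤x : 1# ≤ x
    1≤x = ≤-trans (≤-respˡ-≈ (+-identityʳ 1#) (ι-mono-≤ {1} {2} (s≤s z≤n))) 2≤x

    1+ι≤^ : ∀ n → 1# + ι n ≤ x ^ n
    1+ι≤^ zero    = ≤-reflexive (+-identityʳ 1#)
    1+ι≤^ (suc n) = begin
      1# + (1# + ι n)    ≤⟨ +-mono₂-≤ (1≤^ n 1≤x) (1+ι≤^ n) ⟩
      x ^ n + x ^ n      ≈⟨ solve 1 (λ y → y :+ y := (con (+ 1) :+ con (+ 1)) :* y) refl (x ^ n) ⟩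
      (1# + 1#) * x ^ n  ≈⟨ *-congʳ ι2≈1+1 ⟨
      ι 2 * x ^ n        ≤⟨ *-monoˡ-≤ (^-nonneg n (≤-trans 0≤1 1≤x)) 2≤x ⟩
      x * x ^ n          ∎

  -- If x were positive, some n would satisfy `b / x ≤ ι n`, and the multiple of x by n + 1 would
  -- exceed b.
  ι-bounded⇒≤0 : ∀ {x} b → (∀ n → ι n * x ≤ b) → x ≤ 0#
  ι-bounded⇒≤0 {x} b nx≤b with x≤y⊎y<x x 0#
  ... | inj₁ x≤0 = x≤0
  ... | inj₂ 0<x with archimedean (b / x)
  ...   | n , b/x≤n = contradiction (≤-trans (nx≤b (suc n)) b≤nx) (<⇒≱ nx<[1+n]x)
    where
    b≤nx : b ≤ ι n * x
    b≤nx = begin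
      b          ≈⟨ /-cancel (0<⇒≉0 0<x) ⟨
      b / x * x  ≤⟨ *-monoˡ-≤ (proj₁ 0<x) b/x≤n ⟩
      ι n * x    ∎

    nx<[1+n]x : ι n * x < ι (suc n) * x
    nx<[1+n]x = 0<y-x⇒x<y (≤-respʳ-≈ x≈ (proj₁ 0<x) , λ 0≈ → proj₂ 0<x (trans 0≈ (sym x≈)))
      where
      x≈ : x ≈ ι (suc n) * x - ι n * x
      x≈ = solve 2 (λ i x → x := (con (+ 1) :+ i) :* x :- i :* x) refl (ι n) x

  x≤∣x∣ : ∀ x → x ≤ ∣ x ∣ᴿ
  x≤∣x∣ x = x≤x⊔y x (- x)

  -x≤∣x∣ : ∀ x → - x ≤ ∣ x ∣ᴿ
  -x≤∣x∣ x = x≤y⊔x x (- x)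

  ∣∣-cong : ∀ {x y} → x ≈ y → ∣ x ∣ᴿ ≈ ∣ y ∣ᴿ
  ∣∣-cong x≈y = ⊔-cong x≈y (-‿cong x≈y)

  ∣-∣-≤ : ∀ {x y b} → x - y ≤ b → y - x ≤ b → ∣ x - y ∣ᴿ ≤ b
  ∣-∣-≤ {x} {y} x-y≤b y-x≤b =
    ⊔-lub x-y≤b (≤-respˡ-≈ (solve 2 (λ x y → y :- x := :- (x :- y)) refl x y) y-x≤b)

  ∣∣-*-nonneg : ∀ {x} y → 0# ≤ x → ∣ x * y ∣ᴿ ≤ x * ∣ y ∣ᴿ
  ∣∣-*-nonneg {x} y 0≤x =
    ⊔-lub (*-monoʳ-≤ 0≤x (x≤∣x∣ y))
          (≤-respˡ-≈ (solve 2 (λ x y → x :* :- y := :- (x :* y)) refl x y) (*-monoʳ-≤ 0≤x (-x≤∣x∣ y)))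

  max-nonneg : ∀ {n} (x : Vector Carrier n) → 0# ≤ max x
  max-nonneg {zero}  x = ≤-refl
  max-nonneg {suc n} x = ≤-trans (max-nonneg (x ∘ suc)) (x≤y⊔x _ _)

  ≤max : ∀ {n} (x : Vector Carrier n) i → x i ≤ max x
  ≤max x zero    = x≤x⊔y _ _
  ≤max x (suc i) = ≤-trans (≤max (x ∘ suc) i) (x≤y⊔x _ _)

  max-lub : ∀ {n} (x : Vector Carrier n) {b} → 0# ≤ b → (∀ i → x i ≤ b) → max x ≤ b
  max-lub {zero}  x 0≤b x≤b = 0≤b
  max-lub {suc n} x 0≤b x≤b = ⊔-lub (x≤b zero) (max-lub (x ∘ suc) 0≤b (x≤b ∘ suc))

  -- The fold defining `max` starts from `0#`; a nonempty index set and nonnegative entries ensure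
  -- that this initial value does not exceed all of them.
  max-attained : ∀ {n} (x : Vector Carrier (suc n)) → (∀ i → 0# ≤ x i) → ∃ λ i → x i ≈ max x
  max-attained {zero}  x 0≤x = zero , antisym (x≤x⊔y _ _) (⊔-lub ≤-refl (0≤x zero))
  max-attained {suc n} x 0≤x with ⊔-sel (x zero) (max (x ∘ suc))
  ... | inj₁ max≈x₀ = zero , sym max≈x₀
  ... | inj₂ max≈ with max-attained (x ∘ suc) (0≤x ∘ suc)
  ...   | i , xᵢ≈ = suc i , trans xᵢ≈ (sym max≈)

-- Limits of real sequences

module Limits {r r₁ r₂ : Level} (ℝ : RealNumbers r r₁ r₂) where
  open RealNumbers ℝ hiding (zero)
  open RealProperties ℝ
  open ≤-Reasoning

  -- If the limits violated the bound, half of the excess could serve as ε for both sequences at a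
  -- common index, contradicting the bound there.
  lim-≤ : ∀ {s t a b c} → ConvergesTo s a → ConvergesTo t b →
          (∀ n → s n - t n ≤ c) → a - b ≤ c
  lim-≤ {s} {t} {a} {b} {c} s→a t→b s-t≤c with x≤y⊎y<x (a - b) c
  ... | inj₁ a-b≤c = a-b≤c
  ... | inj₂ c<a-b = contradiction (begin-strict
      a - b
        ≈⟨ solve 4 (λ a b s t → a :- b := (:- (s :- a) :+ (t :- b)) :+ (s :- t))
             refl a b (s n) (t n) ⟩
      (- (s n - a) + (t n - b)) + (s n - t n) ≤⟨ +-mono₂-≤ (+-mono₂-≤ (-x≤∣x∣ _) (x≤∣x∣ _)) (s-t≤c n) ⟩
      (∣ s n - a ∣ᴿ + ∣ t n - b ∣ᴿ) + c       ≤⟨ +-mono-≤ c (+-mono₂-≤ ≤-refl (proj₁ ∣t-b∣<ε)) ⟩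
      (∣ s n - a ∣ᴿ + ε) + c                 <⟨ +ε+c-mono-< ∣s-a∣<ε ⟩
      (ε + ε) + c                            ≈⟨ +-congʳ ε+ε≈ ⟩
      ((a - b) - c) + c                      ≈⟨ solve 2 (λ x c → (x :- c) :+ c := x) refl (a - b) c ⟩
      a - b                                  ∎) (<-irrefl refl)
    where
    ε = ((a - b) - c) / ι 2

    0<ε : 0# < ε
    0<ε = /-positive (x<y⇒0<y-x c<a-b) (ι-positive 1)

    ε+ε≈ : ε + ε ≈ (a - b) - c
    ε+ε≈ = begin-equality
      ε + ε            ≈⟨ solve 1 (λ ε → ε :+ ε := ε :* (con (+ 1) :+ con (+ 1))) refl ε ⟩
      ε * (1# + 1#)    ≈⟨ *-congˡ ι2≈1+1 ⟨
      ε * ι 2          ≈⟨ /-cancel (0<⇒≉0 (ι-positive 1)) ⟩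
      (a - b) - c      ∎

    +ε+c-mono-< : ∀ {x y} → x < y → (x + ε) + c < (y + ε) + c
    +ε+c-mono-< {x} {y} x<y = 0<y-x⇒x<y (≤-respʳ-≈ y-x≈ (proj₁ 0<y-x) , λ 0≈ → proj₂ 0<y-x (trans 0≈ (sym y-x≈)))
      where
      0<y-x = x<y⇒0<y-x x<y
      y-x≈ : y - x ≈ ((y + ε) + c) - ((x + ε) + c)
      y-x≈ = solve 4 (λ x y ε c → y :- x := ((y :+ ε) :+ c) :- ((x :+ ε) :+ c)) refl x y ε c

    n : ℕ
    n = proj₁ (s→a ε 0<ε) ℕ.⊔ proj₁ (t→b ε 0<ε)

    ∣s-a∣<ε : ∣ s n - a ∣ᴿ < ε
    ∣s-a∣<ε = proj₂ (s→a ε 0<ε) n (ℕ.m≤m⊔n _ _)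

    ∣t-b∣<ε : ∣ t n - b ∣ᴿ < ε
    ∣t-b∣<ε = proj₂ (t→b ε 0<ε) n (ℕ.m≤n⊔m (proj₁ (s→a ε 0<ε)) _)

  -- Two sequences are allowed because the functional equation of `G` reaches the same limit through
  -- two different expressions, equal only up to `≈`.
  lim-unique : ∀ {s t a b} → ConvergesTo s a → ConvergesTo t b → (∀ n → s n ≈ t n) → a ≈ b
  lim-unique s→a t→b s≈t =
    antisym (x-y≤0⇒x≤y (lim-≤ s→a t→b λ n → ≤-reflexive (x≈y⇒x-y≈0 (s≈t n))))
            (x-y≤0⇒x≤y (lim-≤ t→b s→a λ n → ≤-reflexive (x≈y⇒x-y≈0 (sym (s≈t n)))))
    where
    x≈y⇒x-y≈0 : ∀ {x y} → x ≈ y → x - y ≈ 0#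
    x≈y⇒x-y≈0 {_} {y} x≈y = trans (+-congʳ x≈y) (-‿inverseʳ y)

    x-y≤0⇒x≤y : ∀ {x y} → x - y ≤ 0# → x ≤ y
    x-y≤0⇒x≤y {x} {y} x-y≤0 = begin
      x            ≈⟨ solve 2 (λ x y → x := (x :- y) :+ y) refl x y ⟩
      (x - y) + y  ≤⟨ +-mono-≤ y x-y≤0 ⟩
      0# + y       ≈⟨ +-identityˡ y ⟩
      y            ∎

  lim-suc : ∀ {s a} → ConvergesTo s a → ConvergesTo (s ∘ suc) a
  lim-suc s→a ε 0<ε = proj₁ (s→a ε 0<ε) , λ n n₀≤n → proj₂ (s→a ε 0<ε) (suc n) (ℕ.m≤n⇒m≤1+n n₀≤n)

  lim-* : ∀ {s a c} → 0# < c → ConvergesTo s a → ConvergesTo (λ n → c * s n) (c * a)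
  lim-* {s} {a} {c} 0<c s→a ε 0<ε = proj₁ close , λ n n₀≤n → begin-strict
    ∣ c * s n - c * a ∣ᴿ  ≈⟨ ∣∣-cong (solve 3 (λ c s a → c :* s :- c :* a := c :* (s :- a)) refl c (s n) a) ⟩
    ∣ c * (s n - a) ∣ᴿ    ≤⟨ ∣∣-*-nonneg _ (proj₁ 0<c) ⟩
    c * ∣ s n - a ∣ᴿ      <⟨ *-monoʳ-< 0<c (proj₂ close n n₀≤n) ⟩
    c * (ε / c)           ≈⟨ *-comm c _ ⟩
    ε / c * c             ≈⟨ /-cancel (0<⇒≉0 0<c) ⟩
    ε                     ∎
    where
    close = s→a (ε / c) (/-positive 0<ε 0<c)

-- Exponential, logarithm and real powers

module ExpLog {r r₁ r₂ : Level} (ℝ : RealNumbers r r₁ r₂) where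
  open RealNumbers ℝ hiding (zero)
  open RealProperties ℝ
  open ≤-Reasoning

  1≤exp : ∀ {x} → 0# ≤ x → 1# ≤ exp x
  1≤exp {x} 0≤x = begin
    1#       ≤⟨ ≤-by 0≤x (solve 1 (λ x → x := (con (+ 1) :+ x) :- con (+ 1)) refl x) ⟩
    1# + x   ≤⟨ 1+x≤exp x ⟩
    exp x    ∎

  exp-0 : exp 0# ≈ 1#
  exp-0 = *-cancelˡ (0<⇒≉0 (<-≤-trans 0<1 (1≤exp ≤-refl))) (begin-equality
    exp 0# * exp 0#  ≈⟨ exp-+ 0# 0# ⟨
    exp (0# + 0#)    ≈⟨ exp-cong (+-identityˡ 0#) ⟩
    exp 0#           ≈⟨ *-identityʳ (exp 0#) ⟨
    exp 0# * 1#      ∎)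

  exp-inverse : ∀ x → exp x * exp (- x) ≈ 1#
  exp-inverse x = trans (sym (exp-+ x (- x))) (trans (exp-cong (-‿inverseʳ x)) exp-0)

  exp-positive : ∀ x → 0# < exp x
  exp-positive x with total 0# x
  ... | inj₁ 0≤x = <-≤-trans 0<1 (1≤exp 0≤x)
  ... | inj₂ x≤0 = ≉0⇒0< 0≤expx (λ expx≈0 → 0≉1 (trans (sym (trans (*-congʳ expx≈0) (zeroˡ _))) (exp-inverse x)))
    where
    0<exp-x : 0# < exp (- x)
    0<exp-x = <-≤-trans 0<1 (1≤exp (≤-respʳ-≈ (+-identityˡ (- x)) (x≤y⇒0≤y-x x≤0)))

    0≤expx : 0# ≤ exp x
    0≤expx = *-cancelˡ-≤ 0<exp-x (begin
      exp (- x) * 0#     ≈⟨ zeroʳ _ ⟩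
      0#                 ≤⟨ 0≤1 ⟩
      1#                 ≈⟨ exp-inverse x ⟨
      exp x * exp (- x)  ≈⟨ *-comm _ _ ⟩
      exp (- x) * exp x  ∎)

  -- Strict growth comes from the tangent bound `1+x≤exp` at `y - x`, multiplied by the positive
  -- number `exp x`.
  exp-mono-< : ∀ {x y} → x < y → exp x < exp y
  exp-mono-< {x} {y} x<y = begin-strict
    exp x                 ≈⟨ *-identityʳ _ ⟨
    exp x * 1#            <⟨ *-monoʳ-< (exp-positive x) 1<1+[y-x] ⟩
    exp x * (1# + (y - x))  ≤⟨ *-monoʳ-≤ (proj₁ (exp-positive x)) (1+x≤exp (y - x)) ⟩
    exp x * exp (y - x)   ≈⟨ exp-+ x (y - x) ⟨
    exp (x + (y - x))     ≈⟨ exp-cong (solve 2 (λ x y → x :+ (y :- x) := y) refl x y) ⟩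
    exp y                 ∎
    where
    0<y-x = x<y⇒0<y-x x<y
    y-x≈ : y - x ≈ (1# + (y - x)) - 1#
    y-x≈ = solve 1 (λ z → z := (con (+ 1) :+ z) :- con (+ 1)) refl (y - x)

    1<1+[y-x] : 1# < 1# + (y - x)
    1<1+[y-x] = 0<y-x⇒x<y (≤-respʳ-≈ y-x≈ (proj₁ 0<y-x) , λ 0≈ → proj₂ 0<y-x (trans 0≈ (sym y-x≈)))

  exp-cancel-≤ : ∀ {x y} → exp x ≤ exp y → x ≤ y
  exp-cancel-≤ {x} {y} ex≤ey with x≤y⊎y<x x y
  ... | inj₁ x≤y = x≤y
  ... | inj₂ y<x = contradiction ex≤ey (<⇒≱ (exp-mono-< y<x))

  exp-injective : ∀ {x y} → exp x ≈ exp y → x ≈ y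
  exp-injective ex≈ey = antisym (exp-cancel-≤ (≤-reflexive ex≈ey)) (exp-cancel-≤ (≤-reflexive (sym ex≈ey)))

  -- `log` is known only as a right inverse of `exp` on positive numbers, so its laws are obtained
  -- by applying `exp` and cancelling it.
  log-mono-≤ : ∀ {x y} → 0# < x → x ≤ y → log x ≤ log y
  log-mono-≤ {x} {y} 0<x x≤y = exp-cancel-≤ (begin
    exp (log x)  ≈⟨ exp-log x 0<x ⟩
    x            ≤⟨ x≤y ⟩
    y            ≈⟨ exp-log y (<-≤-trans 0<x x≤y) ⟨
    exp (log y)  ∎)

  log-* : ∀ {x y} → 0# < x → 0# < y → log (x * y) ≈ log x + log y
  log-* {x} {y} 0<x 0<y = exp-injective (begin-equality
    exp (log (x * y))          ≈⟨ exp-log _ (*-positive 0<x 0<y) ⟩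
    x * y                      ≈⟨ *-cong (exp-log x 0<x) (exp-log y 0<y) ⟨
    exp (log x) * exp (log y)  ≈⟨ exp-+ _ _ ⟨
    exp (log x + log y)        ∎)

  log-1 : log 1# ≈ 0#
  log-1 = exp-injective (trans (exp-log 1# 0<1) (sym exp-0))

  log-^ : ∀ {x} n → 0# < x → log (x ^ n) ≈ ι n * log x
  log-^ zero 0<x = trans log-1 (sym (zeroˡ _))
  log-^ {x} (suc n) 0<x = begin-equality
    log (x * x ^ n)           ≈⟨ log-* 0<x (^-positive n 0<x) ⟩
    log x + log (x ^ n)       ≈⟨ +-congˡ (log-^ n 0<x) ⟩
    log x + ι n * log x       ≈⟨ solve 2 (λ l i → l :+ i :* l := (con (+ 1) :+ i) :* l) refl (log x) (ι n) ⟩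
    ι (suc n) * log x         ∎

  log-nonneg : ∀ {x} → 1# ≤ x → 0# ≤ log x
  log-nonneg 1≤x = ≤-respˡ-≈ log-1 (log-mono-≤ 0<1 1≤x)

  log-positive : ∀ {x} → 1# < x → 0# < log x
  log-positive {x} 1<x = ≉0⇒0< (log-nonneg (proj₁ 1<x)) λ logx≈0 → proj₂ 1<x (begin-equality
    1#           ≈⟨ exp-0 ⟨
    exp 0#       ≈⟨ exp-cong logx≈0 ⟨
    exp (log x)  ≈⟨ exp-log x (<-≤-trans 0<1 (proj₁ 1<x)) ⟩
    x            ∎)

  ^ᴿ-zero : ∀ {x} a → x ≈ 0# → x ^ᴿ a ≈ 0#
  ^ᴿ-zero {x} a x≈0 with x ≟ 0#
  ... | yes _   = refl
  ... | no  x≉0 = contradiction x≈0 x≉0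

  ^ᴿ-exp : ∀ {x} a → 0# < x → x ^ᴿ a ≈ exp (a * log x)
  ^ᴿ-exp {x} a 0<x with x ≟ 0#
  ... | yes x≈0 = contradiction x≈0 (0<⇒≉0 0<x)
  ... | no  _   = refl

  ^ᴿ-congˡ : ∀ {x y} a → x ≈ y → x ^ᴿ a ≈ y ^ᴿ a
  ^ᴿ-congˡ {x} {y} a x≈y with x ≟ 0# | y ≟ 0#
  ... | yes _   | yes _   = refl
  ... | yes x≈0 | no  y≉0 = contradiction (trans (sym x≈y) x≈0) y≉0
  ... | no  x≉0 | yes y≈0 = contradiction (trans x≈y y≈0) x≉0
  ... | no  _   | no  _   = exp-cong (*-congˡ (log-cong x≈y))

  ^ᴿ-positive : ∀ {x} a → 0# < x → 0# < x ^ᴿ a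
  ^ᴿ-positive {x} a 0<x = <-≤-trans (exp-positive (a * log x)) (≤-reflexive (sym (^ᴿ-exp a 0<x)))

  ^ᴿ-distrib-* : ∀ {x y} a → 0# < x → 0# < y → (x * y) ^ᴿ a ≈ x ^ᴿ a * y ^ᴿ a
  ^ᴿ-distrib-* {x} {y} a 0<x 0<y = begin-equality
    (x * y) ^ᴿ a                       ≈⟨ ^ᴿ-exp a (*-positive 0<x 0<y) ⟩
    exp (a * log (x * y))              ≈⟨ exp-cong (*-congˡ (log-* 0<x 0<y)) ⟩
    exp (a * (log x + log y))          ≈⟨ exp-cong (distribˡ a _ _) ⟩
    exp (a * log x + a * log y)        ≈⟨ exp-+ _ _ ⟩
    exp (a * log x) * exp (a * log y)  ≈⟨ *-cong (^ᴿ-exp a 0<x) (^ᴿ-exp a 0<y) ⟨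
    x ^ᴿ a * y ^ᴿ a                    ∎

  1≤^ᴿ : ∀ {x a} → 0# ≤ a → 1# ≤ x → 1# ≤ x ^ᴿ a
  1≤^ᴿ {x} {a} 0≤a 1≤x =
    ≤-respʳ-≈ (sym (^ᴿ-exp a (<-≤-trans 0<1 1≤x))) (1≤exp (*-nonneg 0≤a (log-nonneg 1≤x)))

  -- Taken at x = u and y = d, this is the relation u^α = d that determines the Hölder exponent.
  ^ᴿ-log/log : ∀ {x y} → 1# < x → 0# < y → x ^ᴿ (log y / log x) ≈ y
  ^ᴿ-log/log {x} {y} 1<x 0<y = begin-equality
    x ^ᴿ (log y / log x)         ≈⟨ ^ᴿ-exp _ (<-≤-trans 0<1 (proj₁ 1<x)) ⟩
    exp (log y / log x * log x)  ≈⟨ exp-cong (/-cancel (0<⇒≉0 (log-positive 1<x))) ⟩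
    exp (log y)                  ≈⟨ exp-log y 0<y ⟩
    y                            ∎

-- Univariate polynomials, root counting and a pigeonhole principle

length-filter-∁ : ∀ {a p} {A : Set a} {P : Pred A p} (P? : Decidable P) xs →
                  length (filter P? xs) ℕ.+ length (filter (∁? P?) xs) ≡ length xs
length-filter-∁ P? []       = ≡.refl
length-filter-∁ P? (x ∷ xs) with P? x
... | yes _ = ≡.cong suc (length-filter-∁ P? xs)
... | no  _ = ≡.trans (ℕ.+-suc _ _) (≡.cong suc (length-filter-∁ P? xs))

module UnivariatePolynomials {c ℓ : Level} (K : Field c ℓ) where
  open Field K hiding (zero)
  open FieldProperties K
  open IntegerSolver commutativeRing
  open SetoidReasoning setoid

  horner : List Carrier → Carrier → Carrier
  horner []      t = 0#
  horner (a ∷ p) t = a + t * horner p t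

  -- A coefficient list may end in zeros, so its length only bounds the degree from above; root
  -- counting uses no more than such a bound.
  IsPolynomial : (Carrier → Carrier) → Set (c ⊔ˡ ℓ)
  IsPolynomial f = ∃ λ p → ∀ t → f t ≈ horner p t

  resp : ∀ {f g} → (∀ t → f t ≈ g t) → IsPolynomial g → IsPolynomial f
  resp f≈g (p , g≈p) = p , λ t → trans (f≈g t) (g≈p t)

  const-isPolynomial : ∀ a → IsPolynomial λ _ → a
  const-isPolynomial a = a ∷ [] , λ t → solve 2 (λ a t → a := a :+ t :* con (+ 0)) refl a t

  id-isPolynomial : IsPolynomial λ t → t
  id-isPolynomial = 0# ∷ 1# ∷ [] , λ t →
    solve 1 (λ t → t := con (+ 0) :+ t :* (con (+ 1) :+ t :* con (+ 0))) refl t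

  _⊞_ : List Carrier → List Carrier → List Carrier
  []      ⊞ q       = q
  (a ∷ p) ⊞ []      = a ∷ p
  (a ∷ p) ⊞ (b ∷ q) = a + b ∷ p ⊞ q

  horner-⊞ : ∀ p q t → horner (p ⊞ q) t ≈ horner p t + horner q t
  horner-⊞ []      q       t = sym (+-identityˡ _)
  horner-⊞ (a ∷ p) []      t = sym (+-identityʳ _)
  horner-⊞ (a ∷ p) (b ∷ q) t = trans (+-congˡ (*-congˡ (horner-⊞ p q t)))
    (solve 5 (λ a b t x y → (a :+ b) :+ t :* (x :+ y) := (a :+ t :* x) :+ (b :+ t :* y))
             refl a b t (horner p t) (horner q t))

  length-⊞ : ∀ p q → length (p ⊞ q) ≡ length p ℕ.⊔ length q
  length-⊞ []      q       = ≡.refl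
  length-⊞ (a ∷ p) []      = ≡.refl
  length-⊞ (a ∷ p) (b ∷ q) = ≡.cong suc (length-⊞ p q)

  horner-scale : ∀ k p t → horner (List.map (k *_) p) t ≈ k * horner p t
  horner-scale k []      t = sym (zeroʳ k)
  horner-scale k (a ∷ p) t = trans (+-congˡ (*-congˡ (horner-scale k p t)))
    (solve 4 (λ k a t x → k :* a :+ t :* (k :* x) := k :* (a :+ t :* x)) refl k a t (horner p t))

  _⊠_ : List Carrier → List Carrier → List Carrier
  []      ⊠ q = []
  (a ∷ p) ⊠ q = List.map (a *_) q ⊞ (0# ∷ p ⊠ q)

  horner-⊠ : ∀ p q t → horner (p ⊠ q) t ≈ horner p t * horner q t
  horner-⊠ []      q t = sym (zeroˡ _)
  horner-⊠ (a ∷ p) q t = begin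
    horner (List.map (a *_) q ⊞ (0# ∷ p ⊠ q)) t               ≈⟨ horner-⊞ (List.map (a *_) q) _ t ⟩
    horner (List.map (a *_) q) t + (0# + t * horner (p ⊠ q) t)
      ≈⟨ +-cong (horner-scale a q t) (+-congˡ (*-congˡ (horner-⊠ p q t))) ⟩
    a * y + (0# + t * (x * y))
      ≈⟨ solve 4 (λ a t x y → a :* y :+ (con (+ 0) :+ t :* (x :* y)) := (a :+ t :* x) :* y)
           refl a t x y ⟩
    (a + t * x) * y                                           ∎
    where
    x = horner p t
    y = horner q t

  +-isPolynomial : ∀ {f g} → IsPolynomial f → IsPolynomial g → IsPolynomial λ t → f t + g t
  +-isPolynomial (p , f≈p) (q , g≈q) =
    p ⊞ q , λ t → trans (+-cong (f≈p t) (g≈q t)) (sym (horner-⊞ p q t))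

  *-isPolynomial : ∀ {f g} → IsPolynomial f → IsPolynomial g → IsPolynomial λ t → f t * g t
  *-isPolynomial (p , f≈p) (q , g≈q) =
    p ⊠ q , λ t → trans (*-cong (f≈p t) (g≈q t)) (sym (horner-⊠ p q t))

  -‿isPolynomial : ∀ {f} → IsPolynomial f → IsPolynomial λ t → - f t
  -‿isPolynomial {f} f-poly =
    resp (λ t → solve 1 (λ x → :- x := (:- con (+ 1)) :* x) refl (f t))
         (*-isPolynomial (const-isPolynomial (- 1#)) f-poly)

  ^-isPolynomial : ∀ {f} n → IsPolynomial f → IsPolynomial λ t → f t ^ n
  ^-isPolynomial zero    f-poly = const-isPolynomial 1#
  ^-isPolynomial (suc n) f-poly = *-isPolynomial f-poly (^-isPolynomial n f-poly)

  product-isPolynomial : ∀ {n} (f : Fin n → Carrier → Carrier) → (∀ i → IsPolynomial (f i)) →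
                         IsPolynomial λ t → product λ i → f i t
  product-isPolynomial {zero}  f f-poly = const-isPolynomial 1#
  product-isPolynomial {suc n} f f-poly =
    *-isPolynomial (f-poly zero) (product-isPolynomial (f ∘ suc) (f-poly ∘ suc))

  -- The quotient of a ∷ p by X − s, which does not depend on a.
  quotient : Carrier → List Carrier → List Carrier
  quotient s []      = []
  quotient s (b ∷ p) = horner (b ∷ p) s ∷ quotient s p

  length-quotient : ∀ s p → length (quotient s p) ≡ length p
  length-quotient s []      = ≡.refl
  length-quotient s (b ∷ p) = ≡.cong suc (length-quotient s p)

  horner-quotient : ∀ a p s t →
    horner (a ∷ p) t ≈ horner (a ∷ p) s + (t - s) * horner (quotient s p) t
  horner-quotient a []      s t =
    solve 3 (λ a s t → a :+ t :* con (+ 0) := (a :+ s :* con (+ 0)) :+ (t :- s) :* con (+ 0)) refl a s t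
  horner-quotient a (b ∷ p) s t = begin
    a + t * horner (b ∷ p) t            ≈⟨ +-congˡ (*-congˡ (horner-quotient b p s t)) ⟩
    a + t * (x + (t - s) * y)
      ≈⟨ solve 5 (λ a s t x y → a :+ t :* (x :+ (t :- s) :* y) := (a :+ s :* x) :+ (t :- s) :* (x :+ t :* y))
           refl a s t x y ⟩
    (a + s * x) + (t - s) * (x + t * y) ∎
    where
    x = horner (b ∷ p) s
    y = horner (quotient s p) t

  horner-factor : ∀ a p {s} → horner (a ∷ p) s ≈ 0# → ∀ t →
                  horner (a ∷ p) t ≈ (t - s) * horner (quotient s p) t
  horner-factor a p {s} root t =
    trans (horner-quotient a p s t) (trans (+-congʳ root) (+-identityˡ _))

  Distinct : List Carrier → Set (c ⊔ˡ ℓ)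
  Distinct = AllPairs _≉_

  -- A list of n coefficients has degree below n, so n distinct roots suffice. After dividing by the
  -- factor of one root, the others remain roots of the quotient because a field has no zero
  -- divisors.
  roots-bound : ∀ p ts → length p ℕ.≤ length ts → Distinct ts →
                All (λ s → horner p s ≈ 0#) ts → ∀ t → horner p t ≈ 0#
  roots-bound []      ts       _           _                _              t = refl
  roots-bound (a ∷ p) (s ∷ ts) (s≤s ∣p∣≤∣ts∣) (s≉ts ∷ distinct) (root ∷ roots) t = begin
    horner (a ∷ p) t                  ≈⟨ horner-factor a p root t ⟩
    (t - s) * horner (quotient s p) t ≈⟨ *-congˡ quotient≈0 ⟩
    (t - s) * 0#                      ≈⟨ zeroʳ _ ⟩
    0#                                ∎
    where
    quotient-root : ∀ {t} → s ≉ t × horner (a ∷ p) t ≈ 0# → horner (quotient s p) t ≈ 0#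
    quotient-root {t} (s≉t , root-t) =
      x≉0∧xy≈0⇒y≈0 (s≉t ∘ sym ∘ x-y≈0⇒x≈y) (trans (sym (horner-factor a p root t)) root-t)

    quotient≈0 : horner (quotient s p) t ≈ 0#
    quotient≈0 = roots-bound (quotient s p) ts
      (≡.subst (ℕ._≤ length ts) (≡.sym (length-quotient s p)) ∣p∣≤∣ts∣) distinct
      (All.zipWith quotient-root (s≉ts , roots)) t

  hits? : ∀ (f : Carrier → Carrier) k → Decidable λ t → f t ≈ k
  hits? f k t = f t ≟ k

  -- The values of f are among the roots of p.  If f s is taken less than M
  -- times, discard these arguments and divide p by X − f s.
  pigeonhole : ∀ n p (f : Carrier → Carrier) M ts → length p ≡ n → horner p 0# ≉ 0# →
    Distinct ts → All (λ t → horner p (f t) ≈ 0#) ts → n ℕ.* M ℕ.≤ length ts →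
    ∃ λ k → ∃ λ ts′ → M ℕ.≤ length ts′ × Distinct ts′ × All (λ t → f t ≈ k) ts′
  pigeonhole _       []      f M ts       _ p0≉0 _ _ _    = contradiction refl p0≉0
  -- Without samples the size hypothesis forces M = 0, and any value is taken often enough.
  pigeonhole (suc n) (a ∷ p) f M []       _ _    _ _ M≤0  =
    0# , [] , ℕ.≤-trans (ℕ.m≤m+n M _) M≤0 , [] , []
  pigeonhole (suc n) (a ∷ p) f M ts@(s ∷ _) ∣p∣≡n p0≉0 distinct roots@(root ∷ _) M+nM≤
    with M ℕ.≤? length (filter (hits? f (f s)) ts)
  ... | yes M≤ = f s , _ , M≤ , AllPairs.filter⁺ (hits? f (f s)) distinct , All.all-filter (hits? f (f s)) ts
  ... | no  M≰ = pigeonhole n q f M others ∣q∣≡n q0≉0 (AllPairs.filter⁺ misses? distinct)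
      (All.zipWith q-root (All.all-filter misses? ts , All.filter⁺ misses? roots))
      nM≤
    where
    q = quotient (f s) p
    misses? = ∁? (hits? f (f s))
    others = filter misses? ts

    -- Nonvanishing at `0#` certifies that the polynomial is not identically zero; the certificate
    -- passes to the quotient.
    q0≉0 : horner q 0# ≉ 0#
    q0≉0 q0≈0 = p0≉0 (trans (horner-factor a p root 0#) (trans (*-congˡ q0≈0) (zeroʳ _)))

    q-root : ∀ {t} → f t ≉ f s × horner (a ∷ p) (f t) ≈ 0# → horner q (f t) ≈ 0#
    q-root {t} (ft≉fs , root-t) =
      x≉0∧xy≈0⇒y≈0 (ft≉fs ∘ x-y≈0⇒x≈y) (trans (sym (horner-factor a p root (f t))) root-t)

    ∣q∣≡n : length q ≡ n
    ∣q∣≡n = ≡.trans (length-quotient (f s) p) (ℕ.suc-injective ∣p∣≡n)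

    -- At most M samples were discarded together with the value `f s`.
    nM≤ : n ℕ.* M ℕ.≤ length others
    nM≤ = ℕ.+-cancelˡ-≤ M _ _ (ℕ.≤-trans M+nM≤ (ℕ.≤-trans
      (ℕ.≤-reflexive (≡.sym (length-filter-∁ (hits? f (f s)) ts)))
      (ℕ.+-monoˡ-≤ _ (ℕ.≰⇒≥ M≰))))

-- Evaluation of forms: homogeneity, linearity, polynomial dependence and pure powers

∈-monomials : ∀ {n d} (m : Monomial n d) → m ∈ monomials n d
∈-monomials []                   = here ≡.refl
∈-monomials {d = zero}  (1· m)   = ∈-map⁺ 1·_ (∈-monomials m)
∈-monomials {d = suc _} (1· m)   = ∈-++⁺ˡ (∈-map⁺ 1·_ (∈-monomials m))
∈-monomials (X₀· m)              = ∈-++⁺ʳ _ (∈-map⁺ X₀·_ (∈-monomials m))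

module FormProperties {c ℓ : Level} (K : Field c ℓ) where
  open Field K hiding (zero)
  open FieldProperties K
  open IntegerSolver commutativeRing
  open UnivariatePolynomials K
  open SetoidReasoning setoid

  Σ[_] : ∀ {a} {A : Set a} → List A → (A → Carrier) → Carrier
  Σ[ xs ] f = List.foldr _+_ 0# (List.map f xs)

  Σ-linear : ∀ {a} {A : Set a} (xs : List A) {f g h : A → Carrier} k →
             (∀ x → f x ≈ g x + k * h x) → Σ[ xs ] f ≈ Σ[ xs ] g + k * Σ[ xs ] h
  Σ-linear []       k f≈ = solve 1 (λ k → con (+ 0) := con (+ 0) :+ k :* con (+ 0)) refl k
  Σ-linear (x ∷ xs) {f} {g} {h} k f≈ = trans (+-cong (f≈ x) (Σ-linear xs k f≈))
    (solve 5 (λ g h k s t → (g :+ k :* h) :+ (s :+ k :* t) := (g :+ s) :+ k :* (h :+ t))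
             refl (g x) (h x) k (Σ[ xs ] g) (Σ[ xs ] h))

  Σ-scale : ∀ {a} {A : Set a} (xs : List A) {f h : A → Carrier} k →
            (∀ x → f x ≈ k * h x) → Σ[ xs ] f ≈ k * Σ[ xs ] h
  Σ-scale []       k f≈ = sym (zeroʳ k)
  Σ-scale (x ∷ xs) k f≈ = trans (+-cong (f≈ x) (Σ-scale xs k f≈)) (sym (distribˡ k _ _))

  Σ-cong : ∀ {a} {A : Set a} (xs : List A) {f h : A → Carrier} →
           (∀ x → f x ≈ h x) → Σ[ xs ] f ≈ Σ[ xs ] h
  Σ-cong xs f≈h = trans (Σ-scale xs 1# λ x → trans (f≈h x) (sym (*-identityˡ _))) (*-identityˡ _)

  Σ-++ : ∀ {a} {A : Set a} (xs ys : List A) (f : A → Carrier) →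
         Σ[ xs ++ ys ] f ≈ Σ[ xs ] f + Σ[ ys ] f
  Σ-++ []       ys f = sym (+-identityˡ _)
  Σ-++ (x ∷ xs) ys f = trans (+-congˡ (Σ-++ xs ys f)) (sym (+-assoc _ _ _))

  Σ-map : ∀ {a b} {A : Set a} {B : Set b} (g : A → B) (xs : List A) (f : B → Carrier) →
          Σ[ List.map g xs ] f ≈ Σ[ xs ] (f ∘ g)
  Σ-map g xs f = reflexive (≡.cong (List.foldr _+_ 0#) (≡.sym (List.map-∘ xs)))

  Σ-isPolynomial : ∀ {a} {A : Set a} (xs : List A) (f : A → Carrier → Carrier) →
                   (∀ x → IsPolynomial (f x)) → IsPolynomial λ t → Σ[ xs ] (λ x → f x t)
  Σ-isPolynomial []       f f-poly = const-isPolynomial 0#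
  Σ-isPolynomial (x ∷ xs) f f-poly = +-isPolynomial (f-poly x) (Σ-isPolynomial xs f f-poly)

  value : ∀ {n d} → Monomial n d → Vector Carrier n → Carrier
  value m x = product λ j → x j ^ exponent m j

  -- If `e` is a row of coefficients of a family, this is by computation a coordinate of `evaluate`,
  -- so statements on single forms apply to lifts directly.
  form : ∀ {n d} → (Monomial n d → Carrier) → Vector Carrier n → Carrier
  form e x = Σ[ monomials _ _ ] λ m → e m * value m x

  value-1· : ∀ {n d} (m : Monomial n d) x → value (1· m) x ≈ value m (x ∘ suc)
  value-1· m x = *-identityˡ _

  value-X₀· : ∀ {n d} (m : Monomial (suc n) d) x → value (X₀· m) x ≈ x zero * value m x
  value-X₀· m x = *-assoc _ _ _

  value-cong : ∀ {n d} (m : Monomial n d) {x y} → (∀ j → x j ≈ y j) → value m x ≈ value m y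
  value-cong []      x≈y = refl
  value-cong (1· m)  x≈y = *-congˡ (value-cong m (x≈y ∘ suc))
  value-cong (X₀· m) {x} {y} x≈y = trans (value-X₀· m x)
    (trans (*-cong (x≈y zero) (value-cong m x≈y)) (sym (value-X₀· m y)))

  value-scale : ∀ {n d} (m : Monomial n d) k x → value m (λ j → k * x j) ≈ k ^ d * value m x
  value-scale [] k x = sym (*-identityˡ 1#)
  value-scale {d = d} (1· m)  k x = begin
    value (1· m) (λ j → k * x j)       ≈⟨ value-1· m (λ j → k * x j) ⟩
    value m (λ j → k * x (suc j))      ≈⟨ value-scale m k (x ∘ suc) ⟩
    k ^ d * value m (x ∘ suc)          ≈⟨ *-congˡ (value-1· m x) ⟨
    k ^ d * value (1· m) x             ∎
  value-scale {d = suc d} (X₀· m) k x = begin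
    value (X₀· m) (λ j → k * x j)               ≈⟨ value-X₀· m (λ j → k * x j) ⟩
    k * x zero * value m (λ j → k * x j)        ≈⟨ *-congˡ (value-scale m k x) ⟩
    k * x zero * (k ^ d * value m x)
      ≈⟨ solve 4 (λ k x₀ kᵈ y → k :* x₀ :* (kᵈ :* y) := k :* kᵈ :* (x₀ :* y))
           refl k (x zero) (k ^ d) (value m x) ⟩
    k * k ^ d * (x zero * value m x)            ≈⟨ *-congˡ (value-X₀· m x) ⟨
    k ^ suc d * value (X₀· m) x                 ∎

  form-cong : ∀ {n d} (e : Monomial n d → Carrier) {x y} → (∀ j → x j ≈ y j) → form e x ≈ form e y
  form-cong e x≈y = Σ-cong (monomials _ _) λ m → *-congˡ (value-cong m x≈y)

  form-scale : ∀ {n d} (e : Monomial n d → Carrier) k x → form e (λ j → k * x j) ≈ k ^ d * form e x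
  form-scale {d = d} e k x = Σ-scale (monomials _ _) (k ^ d) λ m →
    trans (*-congˡ (value-scale m k x))
          (solve 3 (λ e kᵈ y → e :* (kᵈ :* y) := kᵈ :* (e :* y)) refl (e m) (k ^ d) (value m x))

  -- This shape covers both perturbations of a family that occur: the pencil Φ - tΨ and the
  -- subtraction of a multiple of a pure power.
  form-linear : ∀ {n d} {e f g : Monomial n d → Carrier} k → (∀ m → e m ≈ f m + k * g m) →
                ∀ x → form e x ≈ form f x + k * form g x
  form-linear {e = e} {f} {g} k e≈ x = Σ-linear (monomials _ _) k λ m →
    trans (*-congʳ (e≈ m))
          (solve 4 (λ f g k y → (f :+ k :* g) :* y := f :* y :+ k :* (g :* y)) refl (f m) (g m) k (value m x))

  form-difference : ∀ {n d} (e : Monomial n d → Carrier) x y →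
    form e x - form e y ≈ Σ[ monomials n d ] λ m → e m * (value m x - value m y)
  form-difference {n} {d} e x y = sym (begin
    (Σ[ monomials n d ] λ m → e m * (value m x - value m y))
      ≈⟨ Σ-linear (monomials n d) (- 1#) (λ m →
           solve 3 (λ e s t → e :* (s :- t) := e :* s :+ (:- con (+ 1)) :* (e :* t))
                refl (e m) (value m x) (value m y)) ⟩
    form e x + - 1# * form e y
      ≈⟨ solve 2 (λ s t → s :+ (:- con (+ 1)) :* t := s :- t) refl (form e x) (form e y) ⟩
    form e x - form e y
      ∎)

  form-isPolynomial : ∀ {n d} (e : Monomial n d → Carrier) (x : Fin n → Carrier → Carrier) →
                      (∀ j → IsPolynomial (x j)) → IsPolynomial λ t → form e (λ j → x j t)
  form-isPolynomial e x x-poly = Σ-isPolynomial (monomials _ _) _ λ m →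
    *-isPolynomial (const-isPolynomial (e m))
                   (product-isPolynomial _ λ j → ^-isPolynomial (exponent m j) (x-poly j))

  -- Applied to a family of forms whose coefficients depend polynomially on a parameter, it makes
  -- their resultant a polynomial in that parameter, to which root counting applies.
  specialise-isPolynomial : ∀ {V} (ρ : Carrier → V → Carrier) → (∀ v → IsPolynomial λ t → ρ t v) →
    ∀ p → IsPolynomial λ t → specialise commutativeRing (ρ t) p
  specialise-isPolynomial ρ ρ-poly (var v) = ρ-poly v
  specialise-isPolynomial ρ ρ-poly (p ⊕ q) =
    +-isPolynomial (specialise-isPolynomial ρ ρ-poly p) (specialise-isPolynomial ρ ρ-poly q)
  specialise-isPolynomial ρ ρ-poly (p ⊛ q) =
    *-isPolynomial (specialise-isPolynomial ρ ρ-poly p) (specialise-isPolynomial ρ ρ-poly q)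
  specialise-isPolynomial ρ ρ-poly (⊖ p)   = -‿isPolynomial (specialise-isPolynomial ρ ρ-poly p)
  specialise-isPolynomial ρ ρ-poly 𝟘       = const-isPolynomial 0#
  specialise-isPolynomial ρ ρ-poly 𝟙       = const-isPolynomial 1#

  -- Mirrors the recursion of `monomials`: one half is free of the first variable, the other is
  -- divisible by it.
  form-split : ∀ {n d} (e : Monomial (suc n) (suc d) → Carrier) x →
               form e x ≈ form (e ∘ 1·_) (x ∘ suc) + x zero * form (e ∘ X₀·_) x
  form-split {n} {d} e x = begin
    form e x
      ≈⟨ Σ-++ (List.map 1·_ (monomials n (suc d))) _ _ ⟩
    Σ[ List.map 1·_ (monomials n (suc d)) ] term + Σ[ List.map X₀·_ (monomials (suc n) d) ] term
      ≈⟨ +-cong (Σ-map 1·_ (monomials n (suc d)) term) (Σ-map X₀·_ (monomials (suc n) d) term) ⟩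
    Σ[ monomials n (suc d) ] (term ∘ 1·_) + Σ[ monomials (suc n) d ] (term ∘ X₀·_)
      ≈⟨ +-cong (Σ-cong (monomials n (suc d)) λ m → *-congˡ (value-1· m x))
                (Σ-scale (monomials (suc n) d) (x zero) λ m → trans (*-congˡ (value-X₀· m x))
                  (solve 3 (λ e x₀ y → e :* (x₀ :* y) := x₀ :* (e :* y))
                       refl (e (X₀· m)) (x zero) (value m x))) ⟩
    form (e ∘ 1·_) (x ∘ suc) + x zero * form (e ∘ X₀·_) x
      ∎
    where
    term : Monomial (suc n) (suc d) → Carrier
    term m = e m * value m x

  form-1· : ∀ {n} (e : Monomial (suc n) 0 → Carrier) x → form e x ≈ form (e ∘ 1·_) (x ∘ suc)
  form-1· {n} e x = trans (Σ-map 1·_ (monomials n 0) (λ m → e m * value m x))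
                          (Σ-cong (monomials n 0) λ m → *-congˡ (value-1· m x))

  form-0 : ∀ {n} d x → form {n} {d} (λ _ → 0#) x ≈ 0#
  form-0 {n} d x = trans (Σ-scale (monomials n d) {h = λ _ → 0#} 0# (λ m → trans (zeroˡ (value m x)) (sym (zeroʳ 0#)))) (zeroˡ _)

  form-degree-0 : ∀ {n} x → form {n} {0} (λ _ → 1#) x ≈ 1#
  form-degree-0 {zero}  x = solve 0 (con (+ 1) :* con (+ 1) :+ con (+ 0) := con (+ 1)) refl
  form-degree-0 {suc n} x = trans (form-1· (λ _ → 1#) x) (form-degree-0 (x ∘ suc))

  -- The coefficients of the d-th power of the i-th variable. Recursion along the monomial, in place
  -- of a comparison of exponents, lets the evaluation follow `form-split`.
  power : ∀ {n} → Fin n → ∀ d → Monomial n d → Carrier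
  power i       zero    m       = 1#
  power zero    (suc d) (1· m)  = 0#
  power zero    (suc d) (X₀· m) = power zero d m
  power (suc i) (suc d) (1· m)  = power i (suc d) m
  power (suc i) (suc d) (X₀· m) = 0#

  form-power : ∀ {n} (i : Fin n) d x → form (power i d) x ≈ x i ^ d
  form-power i       zero    x = form-degree-0 x
  form-power zero    (suc d) x = begin
    form (power zero (suc d)) x                         ≈⟨ form-split (power zero (suc d)) x ⟩
    form (λ m → 0#) (x ∘ suc) + x zero * form (power zero d) x
                                                        ≈⟨ +-cong (form-0 (suc d) (x ∘ suc)) (*-congˡ (form-power zero d x)) ⟩
    0# + x zero * x zero ^ d                            ≈⟨ +-identityˡ _ ⟩
    x zero ^ suc d                                      ∎
  form-power (suc i) (suc d) x = begin
    form (power (suc i) (suc d)) x                      ≈⟨ form-split (power (suc i) (suc d)) x ⟩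
    form (power i (suc d)) (x ∘ suc) + x zero * form {d = d} (λ m → 0#) x
                                                        ≈⟨ +-cong (form-power i (suc d) (x ∘ suc)) (trans (*-congˡ (form-0 d x)) (zeroʳ _)) ⟩
    x (suc i) ^ suc d + 0#                              ≈⟨ +-identityʳ _ ⟩
    x (suc i) ^ suc d                                   ∎

-- Ultrametric estimates for forms and integral polynomials

module AbsoluteValueProperties {r r₁ r₂ c ℓ : Level} {ℝ : RealNumbers r r₁ r₂} {K : Field c ℓ}
                               (v : NonarchimedeanAbsoluteValue ℝ K) where
  open RealNumbers ℝ hiding (zero)
  open RealProperties ℝ hiding (∣∣-cong)
  open NonarchimedeanAbsoluteValue v
  open FormProperties K using (Σ[_]; value; form; value-1·; value-X₀·; form-difference; power)
  open ≤-Reasoning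
  private
    module K where
      open Field K public
      open FieldProperties K public
      open IntegerSolver (Field.commutativeRing K) public

  ∣0∣≈0 : ∣ K.0# ∣ ≈ 0#
  ∣0∣≈0 = Equivalence.from (zero⇔ K.0#) K.refl

  x≉0⇒0<∣x∣ : ∀ {x} → x K.≉ K.0# → 0# < ∣ x ∣
  x≉0⇒0<∣x∣ {x} x≉0 = ≉0⇒0< (nonneg x) (x≉0 ∘ Equivalence.to (zero⇔ x))

  ∣1∣≈1 : ∣ K.1# ∣ ≈ 1#
  ∣1∣≈1 = *-cancelˡ (0<⇒≉0 (x≉0⇒0<∣x∣ K.1≉0)) (begin-equality
    ∣ K.1# ∣ * ∣ K.1# ∣  ≈⟨ ∣∣-* _ _ ⟨
    ∣ K.1# K.* K.1# ∣    ≈⟨ ∣∣-cong (K.*-identityˡ K.1#) ⟩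
    ∣ K.1# ∣             ≈⟨ *-identityʳ _ ⟨
    ∣ K.1# ∣ * 1#        ∎)

  private
    nonneg-sqrt : ∀ {x} → 0# ≤ x → x * x ≈ 1# → x ≈ 1#
    nonneg-sqrt {x} 0≤x x²≈1 = x-y≈0⇒x≈y (x≉0∧xy≈0⇒y≈0 (0<⇒≉0 (+-positive 0<1 0≤x)) (begin-equality
      (1# + x) * (x - 1#)
        ≈⟨ solve 1 (λ x → (con (+ 1) :+ x) :* (x :- con (+ 1)) := x :* x :- con (+ 1)) refl x ⟩
      x * x - 1#           ≈⟨ +-congʳ x²≈1 ⟩
      1# - 1#              ≈⟨ -‿inverseʳ 1# ⟩
      0#                   ∎))

  ∣-1∣≈1 : ∣ K.- K.1# ∣ ≈ 1#
  ∣-1∣≈1 = nonneg-sqrt (nonneg _) (begin-equality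
    ∣ K.- K.1# ∣ * ∣ K.- K.1# ∣  ≈⟨ ∣∣-* _ _ ⟨
    ∣ K.- K.1# K.* K.- K.1# ∣
      ≈⟨ ∣∣-cong (K.solve 0 (K.:- K.con (+ 1) K.:* K.:- K.con (+ 1) K.:= K.con (+ 1)) K.refl) ⟩
    ∣ K.1# ∣                     ≈⟨ ∣1∣≈1 ⟩
    1#                           ∎)

  ∣-x∣≈∣x∣ : ∀ x → ∣ K.- x ∣ ≈ ∣ x ∣
  ∣-x∣≈∣x∣ x = begin-equality
    ∣ K.- x ∣               ≈⟨ ∣∣-cong (K.solve 1 (λ x → K.:- x K.:= (K.:- K.con (+ 1)) K.:* x) K.refl x) ⟩
    ∣ K.- K.1# K.* x ∣      ≈⟨ ∣∣-* _ _ ⟩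
    ∣ K.- K.1# ∣ * ∣ x ∣    ≈⟨ *-congʳ ∣-1∣≈1 ⟩
    1# * ∣ x ∣              ≈⟨ *-identityˡ _ ⟩
    ∣ x ∣                   ∎

  ∣^∣ : ∀ x n → ∣ x K.^ n ∣ ≈ ∣ x ∣ ^ n
  ∣^∣ x zero    = ∣1∣≈1
  ∣^∣ x (suc n) = trans (∣∣-* x _) (*-congˡ (∣^∣ x n))

  ∣+∣≤ : ∀ {x y b} → ∣ x ∣ ≤ b → ∣ y ∣ ≤ b → ∣ x K.+ y ∣ ≤ b
  ∣+∣≤ ∣x∣≤b ∣y∣≤b = ≤-trans (ultrametric _ _) (⊔-lub ∣x∣≤b ∣y∣≤b)

  ∣-∣≤ : ∀ {x y b} → ∣ x ∣ ≤ b → ∣ y ∣ ≤ b → ∣ x K.- y ∣ ≤ b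
  ∣-∣≤ ∣x∣≤b ∣y∣≤b = ∣+∣≤ ∣x∣≤b (≤-respˡ-≈ (sym (∣-x∣≈∣x∣ _)) ∣y∣≤b)

  ∣*∣≤ : ∀ {x y a b} → ∣ x ∣ ≤ a → ∣ y ∣ ≤ b → ∣ x K.* y ∣ ≤ a * b
  ∣*∣≤ {x} {y} {a} {b} ∣x∣≤a ∣y∣≤b = begin
    ∣ x K.* y ∣      ≈⟨ ∣∣-* x y ⟩
    ∣ x ∣ * ∣ y ∣    ≤⟨ *-mono₂-≤ (nonneg x) (≤-trans (nonneg y) ∣y∣≤b) ∣x∣≤a ∣y∣≤b ⟩
    a * b            ∎

  ∣0∣≤ : ∀ {b} → 0# ≤ b → ∣ K.0# ∣ ≤ b
  ∣0∣≤ 0≤b = ≤-respˡ-≈ (sym ∣0∣≈0) 0≤b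

  ∣x∣≤∣x-y∣⊔∣y∣ : ∀ x y → ∣ x ∣ ≤ ∣ x K.- y ∣ ⊔ ∣ y ∣
  ∣x∣≤∣x-y∣⊔∣y∣ x y = ≤-respˡ-≈
    (∣∣-cong (K.solve 2 (λ x y → (x K.:- y) K.:+ y K.:= x) K.refl x y)) (ultrametric (x K.- y) y)

  -- Half of the isosceles triangle principle: |x| is at most the larger of |x - y| and |y|, and the
  -- hypothesis rules out the former.
  ∣x-y∣<∣x∣⇒∣x∣≤∣y∣ : ∀ {x y} → ∣ x K.- y ∣ < ∣ x ∣ → ∣ x ∣ ≤ ∣ y ∣
  ∣x-y∣<∣x∣⇒∣x∣≤∣y∣ {x} {y} ∣x-y∣<∣x∣ with x≤y⊎y<x (∣ x ∣) (∣ y ∣)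
  ... | inj₁ ∣x∣≤∣y∣ = ∣x∣≤∣y∣
  ... | inj₂ ∣y∣<∣x∣ with ⊔-sel (∣ x K.- y ∣) (∣ y ∣)
  ...   | inj₁ ⊔≈∣x-y∣ = contradiction (≤-trans (∣x∣≤∣x-y∣⊔∣y∣ x y) (≤-reflexive ⊔≈∣x-y∣)) (<⇒≱ ∣x-y∣<∣x∣)
  ...   | inj₂ ⊔≈∣y∣ = ≤-trans (∣x∣≤∣x-y∣⊔∣y∣ x y) (≤-reflexive ⊔≈∣y∣)

  Σ-bound : ∀ {a} {A : Set a} (xs : List A) (f : A → K.Carrier) {b} → 0# ≤ b →
            (∀ x → ∣ f x ∣ ≤ b) → ∣ Σ[ xs ] f ∣ ≤ b
  Σ-bound []       f 0≤b ∣f∣≤b = ∣0∣≤ 0≤b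
  Σ-bound (x ∷ xs) f 0≤b ∣f∣≤b = ∣+∣≤ (∣f∣≤b x) (Σ-bound xs f 0≤b ∣f∣≤b)

  value-bound : ∀ {n d} (m : Monomial n d) x {s} → (∀ j → ∣ x j ∣ ≤ s) → ∣ value m x ∣ ≤ s ^ d
  value-bound []      x ∣x∣≤s = ≤-reflexive ∣1∣≈1
  value-bound (1· m)  x ∣x∣≤s =
    ≤-respˡ-≈ (∣∣-cong (K.sym (value-1· m x))) (value-bound m (x ∘ suc) (∣x∣≤s ∘ suc))
  value-bound (X₀· m) x ∣x∣≤s =
    ≤-respˡ-≈ (∣∣-cong (K.sym (value-X₀· m x))) (∣*∣≤ (∣x∣≤s zero) (value-bound m x ∣x∣≤s))

  -- Differences are measured relative to the size s of the arguments, so each further variable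
  -- contributes exactly one factor s. The two terms of the product rule are combined by a maximum,
  -- so no factor d appears.
  value-lipschitz : ∀ {n d} (m : Monomial n d) x y {s δ} → 0# ≤ s → 0# ≤ δ →
    (∀ j → ∣ x j ∣ ≤ s) → (∀ j → ∣ y j ∣ ≤ s) → (∀ j → ∣ x j K.- y j ∣ ≤ δ * s) →
    ∣ value m x K.- value m y ∣ ≤ δ * s ^ d
  value-lipschitz []      x y 0≤s 0≤δ _ _ _ =
    ≤-respˡ-≈ (∣∣-cong (K.sym (K.-‿inverseʳ K.1#))) (∣0∣≤ (*-nonneg 0≤δ 0≤1))
  value-lipschitz (1· m)  x y 0≤s 0≤δ ∣x∣≤s ∣y∣≤s ∣x-y∣≤δs =
    ≤-respˡ-≈ (∣∣-cong (K.sym (K.+-cong (value-1· m x) (K.-‿cong (value-1· m y)))))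
      (value-lipschitz m (x ∘ suc) (y ∘ suc) 0≤s 0≤δ (∣x∣≤s ∘ suc) (∣y∣≤s ∘ suc) (∣x-y∣≤δs ∘ suc))
  value-lipschitz {d = suc d} (X₀· m) x y {s} {δ} 0≤s 0≤δ ∣x∣≤s ∣y∣≤s ∣x-y∣≤δs = begin
    ∣ value (X₀· m) x K.- value (X₀· m) y ∣
      ≈⟨ ∣∣-cong (K.+-cong (value-X₀· m x) (K.-‿cong (value-X₀· m y))) ⟩
    ∣ x zero K.* value m x K.- y zero K.* value m y ∣
      ≈⟨ ∣∣-cong (K.solve 4 (λ x y s t → x K.:* s K.:- y K.:* t K.:= x K.:* (s K.:- t) K.:+ (x K.:- y) K.:* t)
           K.refl (x zero) (y zero) (value m x) (value m y)) ⟩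
    ∣ x zero K.* (value m x K.- value m y) K.+ (x zero K.- y zero) K.* value m y ∣
      ≤⟨ ∣+∣≤ (≤-respʳ-≈ (solve 3 (λ s δ t → s :* (δ :* t) := δ :* (s :* t)) refl s δ (s ^ d))
                (∣*∣≤ (∣x∣≤s zero) (value-lipschitz m x y 0≤s 0≤δ ∣x∣≤s ∣y∣≤s ∣x-y∣≤δs)))
              (≤-respʳ-≈ (*-assoc δ s _) (∣*∣≤ (∣x-y∣≤δs zero) (value-bound m y ∣y∣≤s))) ⟩
    δ * s ^ suc d
      ∎

  form-bound : ∀ {n d} (e : Monomial n d → K.Carrier) x {s} → (∀ m → ∣ e m ∣ ≤ 1#) →
               0# ≤ s → (∀ j → ∣ x j ∣ ≤ s) → ∣ form e x ∣ ≤ s ^ d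
  form-bound {d = d} e x ∣e∣≤1 0≤s ∣x∣≤s = Σ-bound (monomials _ _) _ (^-nonneg d 0≤s) λ m →
    ≤-respʳ-≈ (*-identityˡ _) (∣*∣≤ (∣e∣≤1 m) (value-bound m x ∣x∣≤s))

  form-lipschitz : ∀ {n d} (e : Monomial n d → K.Carrier) x y {s δ} → (∀ m → ∣ e m ∣ ≤ 1#) →
    0# ≤ s → 0# ≤ δ →
    (∀ j → ∣ x j ∣ ≤ s) → (∀ j → ∣ y j ∣ ≤ s) → (∀ j → ∣ x j K.- y j ∣ ≤ δ * s) →
    ∣ form e x K.- form e y ∣ ≤ δ * s ^ d
  form-lipschitz {d = d} e x y ∣e∣≤1 0≤s 0≤δ ∣x∣≤s ∣y∣≤s ∣x-y∣≤δs =
    ≤-respˡ-≈ (∣∣-cong (K.sym (form-difference e x y)))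
      (Σ-bound (monomials _ _) _ (*-nonneg 0≤δ (^-nonneg d 0≤s)) λ m →
        ≤-respʳ-≈ (*-identityˡ _)
          (∣*∣≤ (∣e∣≤1 m) (value-lipschitz m x y 0≤s 0≤δ ∣x∣≤s ∣y∣≤s ∣x-y∣≤δs)))

  power-bound : ∀ {n} (i : Fin n) d m → ∣ power i d m ∣ ≤ 1#
  power-bound i       zero    m       = ≤-reflexive ∣1∣≈1
  power-bound zero    (suc d) (1· m)  = ∣0∣≤ 0≤1
  power-bound zero    (suc d) (X₀· m) = power-bound zero d m
  power-bound (suc i) (suc d) (1· m)  = power-bound i (suc d) m
  power-bound (suc i) (suc d) (X₀· m) = ∣0∣≤ 0≤1

  specialise-bound : ∀ {V} (ρ : V → K.Carrier) → (∀ v → ∣ ρ v ∣ ≤ 1#) →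
                     ∀ p → ∣ specialise K.commutativeRing ρ p ∣ ≤ 1#
  specialise-bound ρ ∣ρ∣≤1 (var v) = ∣ρ∣≤1 v
  specialise-bound ρ ∣ρ∣≤1 (p ⊕ q) = ∣+∣≤ (specialise-bound ρ ∣ρ∣≤1 p) (specialise-bound ρ ∣ρ∣≤1 q)
  specialise-bound ρ ∣ρ∣≤1 (p ⊛ q) = ≤-respʳ-≈ (*-identityˡ 1#)
    (∣*∣≤ (specialise-bound ρ ∣ρ∣≤1 p) (specialise-bound ρ ∣ρ∣≤1 q))
  specialise-bound ρ ∣ρ∣≤1 (⊖ p)   = ≤-respˡ-≈ (sym (∣-x∣≈∣x∣ _)) (specialise-bound ρ ∣ρ∣≤1 p)
  specialise-bound ρ ∣ρ∣≤1 𝟘       = ∣0∣≤ 0≤1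
  specialise-bound ρ ∣ρ∣≤1 𝟙       = ≤-reflexive ∣1∣≈1

  -- Integral polynomials are 1-Lipschitz on the closed unit polydisc: in ab - a′b′ = a(b - b′) + (a
  -- - a′)b′ the factors a and b′ have absolute value at most one. A nearby family with resultant
  -- zero therefore bounds the resultant.
  specialise-lipschitz : ∀ {V} (ρ σ : V → K.Carrier) {δ} → 0# ≤ δ →
    (∀ v → ∣ ρ v ∣ ≤ 1#) → (∀ v → ∣ σ v ∣ ≤ 1#) → (∀ v → ∣ ρ v K.- σ v ∣ ≤ δ) →
    ∀ p → ∣ specialise K.commutativeRing ρ p K.- specialise K.commutativeRing σ p ∣ ≤ δ
  specialise-lipschitz ρ σ {δ} 0≤δ ∣ρ∣≤1 ∣σ∣≤1 ∣ρ-σ∣≤δ = bound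
    where
    s = specialise K.commutativeRing ρ
    t = specialise K.commutativeRing σ

    bound : ∀ p → ∣ s p K.- t p ∣ ≤ δ
    bound (var v) = ∣ρ-σ∣≤δ v
    bound (p ⊕ q) = ≤-respˡ-≈
      (∣∣-cong (K.solve 4 (λ s s′ t t′ → (s K.:- t) K.:+ (s′ K.:- t′) K.:= (s K.:+ s′) K.:- (t K.:+ t′))
           K.refl (s p) (s q) (t p) (t q)))
      (∣+∣≤ (bound p) (bound q))
    bound (p ⊛ q) = ≤-respˡ-≈
      (∣∣-cong (K.solve 4 (λ s s′ t t′ → s K.:* (s′ K.:- t′) K.:+ (s K.:- t) K.:* t′ K.:=
             (s K.:* s′) K.:- (t K.:* t′))
           K.refl (s p) (s q) (t p) (t q)))
      (∣+∣≤ (≤-respʳ-≈ (*-identityˡ δ) (∣*∣≤ (specialise-bound ρ ∣ρ∣≤1 p) (bound q)))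
            (≤-respʳ-≈ (*-identityʳ δ) (∣*∣≤ (bound p) (specialise-bound σ ∣σ∣≤1 q))))
    bound (⊖ p)   = ≤-respˡ-≈
      (trans (sym (∣-x∣≈∣x∣ _)) (∣∣-cong (K.solve 2 (λ s t → K.:- (s K.:- t) K.:= K.:- s K.:- (K.:- t))
           K.refl (s p) (t p))))
      (bound p)
    bound 𝟘       = ≤-respˡ-≈ (∣∣-cong (K.sym (K.-‿inverseʳ K.0#))) (∣0∣≤ 0≤δ)
    bound 𝟙       = ≤-respˡ-≈ (∣∣-cong (K.sym (K.-‿inverseʳ K.1#))) (∣0∣≤ 0≤δ)

-- Norms, chordal distance and the lower bound from the resultant

module NormProperties {r r₁ r₂ c ℓ : Level} {ℝ : RealNumbers r r₁ r₂} {K : Field c ℓ}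
                      (v : NonarchimedeanAbsoluteValue ℝ K) (N : ℕ) where
  open RealNumbers ℝ hiding (zero)
  open RealProperties ℝ hiding (∣∣-cong)
  open NonarchimedeanAbsoluteValue v
  open AbsoluteValueProperties v
  open FormProperties K using (form; form-scale; form-linear; form-power; power)
  open Dynamics v N
  open ≤-Reasoning
  private
    module K where
      open Field K public
      open FieldProperties K public
      open IntegerSolver (Field.commutativeRing K) public

  ∣∣≤‖‖ : ∀ {n} (x : Vector K.Carrier n) i → ∣ x i ∣ ≤ ‖ x ‖
  ∣∣≤‖‖ x = ≤max (∣_∣ ∘ x)

  ‖‖-nonneg : ∀ {n} (x : Vector K.Carrier n) → 0# ≤ ‖ x ‖
  ‖‖-nonneg x = max-nonneg (∣_∣ ∘ x)

  ‖‖-lub : ∀ {n} (x : Vector K.Carrier n) {b} → 0# ≤ b → (∀ i → ∣ x i ∣ ≤ b) → ‖ x ‖ ≤ b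
  ‖‖-lub x = max-lub (∣_∣ ∘ x)

  ‖‖-attained : ∀ {n} (x : Vector K.Carrier (suc n)) → ∃ λ i → ∣ x i ∣ ≈ ‖ x ‖
  ‖‖-attained x = max-attained (∣_∣ ∘ x) (nonneg ∘ x)

  ‖‖-positive : ∀ {n} {x : Vector K.Carrier n} → ¬ IsZero K x → 0# < ‖ x ‖
  ‖‖-positive {x = x} x≢0 = ≉0⇒0< (‖‖-nonneg x) λ ‖x‖≈0 → x≢0 λ i →
    Equivalence.to (zero⇔ (x i)) (antisym (≤-trans (∣∣≤‖‖ x i) (≤-reflexive ‖x‖≈0)) (nonneg (x i)))

  private
    ≤-foldr-⊔ : ∀ {a} {A : Set a} (f : A → Carrier) {x xs} → x ∈ xs →
               f x ≤ List.foldr _⊔_ 0# (List.map f xs)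
    ≤-foldr-⊔ f (here ≡.refl)  = x≤x⊔y _ _
    ≤-foldr-⊔ f (there x∈xs)   = ≤-trans (≤-foldr-⊔ f x∈xs) (x≤y⊔x _ _)

  Integral : ∀ {d} → Forms K.Carrier N d → Set r₂
  Integral Φ = ∀ j → ∣ Φ j ∣ ≤ 1#

  minimal⇒integral : ∀ {d} (Φ : Forms K.Carrier N d) → Minimal Φ → Integral Φ
  minimal⇒integral {d} Φ ‖Φ‖≈1 (i , m) = begin
    ∣ Φ (i , m) ∣ ≤⟨ ≤-foldr-⊔ (λ m → ∣ Φ (i , m) ∣) (∈-monomials m) ⟩
    row i         ≤⟨ ≤max row i ⟩
    ‖ Φ ‖ᶠ        ≈⟨ ‖Φ‖≈1 ⟩
    1#            ∎
    where
    row : Vector Carrier (suc N)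
    row i = List.foldr _⊔_ 0# (List.map (λ m → ∣ Φ (i , m) ∣) (monomials (suc N) d))

  minor : (x y : Vector K.Carrier (suc N)) → Fin (suc N) → Fin (suc N) → Carrier
  minor x y i j = ∣ x i K.* y j K.- x j K.* y i ∣

  wedge : (x y : Vector K.Carrier (suc N)) → Carrier
  wedge x y = max λ i → max (minor x y i)

  -- `Δ` on representatives, by computation. Leaving out the proofs that the vectors are nonzero
  -- makes it convenient along orbits.
  δ : (x y : Vector K.Carrier (suc N)) → Carrier
  δ x y = wedge x y / (‖ x ‖ * ‖ y ‖)

  minor≤wedge : ∀ x y i j → minor x y i j ≤ wedge x y
  minor≤wedge x y i j = ≤-trans (≤max (minor x y i) j) (≤max (λ i → max (minor x y i)) i)

  wedge-nonneg : ∀ x y → 0# ≤ wedge x y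
  wedge-nonneg x y = max-nonneg λ i → max (minor x y i)

  wedge-lub : ∀ x y {b} → 0# ≤ b → (∀ i j → minor x y i j ≤ b) → wedge x y ≤ b
  wedge-lub x y 0≤b ≤b = max-lub _ 0≤b λ i → max-lub (minor x y i) 0≤b (≤b i)

  module _ {x y : Vector K.Carrier (suc N)} (x≢0 : ¬ IsZero K x) (y≢0 : ¬ IsZero K y) where
    private
      0<M : 0# < ‖ x ‖ * ‖ y ‖
      0<M = *-positive (‖‖-positive x≢0) (‖‖-positive y≢0)

    δ-nonneg : 0# ≤ δ x y
    δ-nonneg = *-nonneg (wedge-nonneg x y) (proj₁ (⁻¹-positive 0<M))

    δ*‖x‖‖y‖≈wedge : δ x y * (‖ x ‖ * ‖ y ‖) ≈ wedge x y
    δ*‖x‖‖y‖≈wedge = /-cancel (0<⇒≉0 0<M)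

  module _ {d} (Φ : Forms K.Carrier N d) (integral : Integral Φ) where
    private
      F : Vector K.Carrier (suc N) → Vector K.Carrier (suc N)
      F = evaluate K.commutativeRing Φ

    evaluate-bound : ∀ x → ‖ F x ‖ ≤ ‖ x ‖ ^ d
    evaluate-bound x = ‖‖-lub (F x) (^-nonneg d (‖‖-nonneg x)) λ i →
      form-bound (λ m → Φ (i , m)) x (λ m → integral (i , m)) (‖‖-nonneg x) (∣∣≤‖‖ x)

    -- Φ′ vanishes at x, so its resultant is zero, and its coefficients differ
    -- by at most ε from those of Φ.
    evaluate-lower-bound : ∀ Res →
      (∀ Φ′ → HasNontrivialZero K {N} {d} Φ′ → specialise K.commutativeRing Φ′ Res K.≈ K.0#) →
      ∀ x → ¬ IsZero K x → ∣ specialise K.commutativeRing Φ Res ∣ * ‖ x ‖ ^ d ≤ ‖ F x ‖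
    evaluate-lower-bound Res vanishing x x≢0 = begin
      ∣ ρ ∣ * s ^ d         ≤⟨ *-monoˡ-≤ (proj₁ 0<sᵈ) ∣ρ∣≤ε ⟩
      ‖ F x ‖ / s ^ d * s ^ d ≈⟨ /-cancel (0<⇒≉0 0<sᵈ) ⟩
      ‖ F x ‖               ∎
      where
      ρ = specialise K.commutativeRing Φ Res
      s = ‖ x ‖
      ε = ‖ F x ‖ / s ^ d
      i = proj₁ (‖‖-attained x)

      0<sᵈ : 0# < s ^ d
      0<sᵈ = ^-positive d (‖‖-positive x≢0)

      0≤ε : 0# ≤ ε
      0≤ε = *-nonneg (‖‖-nonneg (F x)) (proj₁ (⁻¹-positive 0<sᵈ))

      ∣xᵢᵈ∣≈sᵈ : ∣ x i K.^ d ∣ ≈ s ^ d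
      ∣xᵢᵈ∣≈sᵈ = trans (∣^∣ (x i) d) (^-congˡ d (proj₂ (‖‖-attained x)))

      xᵢᵈ≉0 : x i K.^ d K.≉ K.0#
      xᵢᵈ≉0 xᵢᵈ≈0 = 0<⇒≉0 0<sᵈ (trans (sym ∣xᵢᵈ∣≈sᵈ) (trans (∣∣-cong xᵢᵈ≈0) ∣0∣≈0))

      k : Fin (suc N) → K.Carrier
      k j = F x j K./ x i K.^ d

      ∣k∣≤ε : ∀ j → ∣ k j ∣ ≤ ε
      ∣k∣≤ε j = ≤-/ 0<sᵈ (begin
        s ^ d * ∣ k j ∣         ≈⟨ *-congʳ ∣xᵢᵈ∣≈sᵈ ⟨
        ∣ x i K.^ d ∣ * ∣ k j ∣ ≈⟨ ∣∣-* _ _ ⟨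
        ∣ x i K.^ d K.* k j ∣   ≈⟨ ∣∣-cong (K.trans (K.*-comm _ _) (K./-cancel xᵢᵈ≉0)) ⟩
        ∣ F x j ∣               ≤⟨ ∣∣≤‖‖ (F x) j ⟩
        ‖ F x ‖                 ∎)

      -- Keeps the coefficients of `Φ′` in the closed unit disc, where the Lipschitz estimate for
      -- the resultant is valid.
      ε≤1 : ε ≤ 1#
      ε≤1 = /-≤ 0<sᵈ (≤-respʳ-≈ (sym (*-identityˡ _)) (evaluate-bound x))

      Φ′ : Forms K.Carrier N d
      Φ′ (j , m) = Φ (j , m) K.+ (K.- k j) K.* power i d m

      ∣kXᵢᵈ∣≤ε : ∀ j m → ∣ (K.- k j) K.* power i d m ∣ ≤ ε
      ∣kXᵢᵈ∣≤ε j m = ≤-respʳ-≈ (*-identityʳ ε)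
        (∣*∣≤ (≤-respˡ-≈ (sym (∣-x∣≈∣x∣ (k j))) (∣k∣≤ε j)) (power-bound i d m))

      Φ′x≈0 : ∀ j → evaluate K.commutativeRing Φ′ x j K.≈ K.0#
      Φ′x≈0 j = K.trans (form-linear {d = d} {e = λ m → Φ′ (j , m)} (K.- k j) (λ m → K.refl) x)
        (K.trans (K.+-cong (K.sym (K./-cancel xᵢᵈ≉0)) (K.*-congˡ (form-power i d x)))
                 (K.solve 2 (λ k y → k K.:* y K.:+ (K.:- k) K.:* y K.:= K.con (+ 0))
                      K.refl (k j) (x i K.^ d)))

      ρ′≈0 : specialise K.commutativeRing Φ′ Res K.≈ K.0#
      ρ′≈0 = vanishing Φ′ (x , x≢0 , Φ′x≈0)

      ∣ρ∣≤ε : ∣ ρ ∣ ≤ ε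
      ∣ρ∣≤ε = ≤-respˡ-≈
        (∣∣-cong (K.trans (K.+-congˡ (K.-‿cong ρ′≈0)) (K.solve 1 (λ s → s K.:- K.con (+ 0) K.:= s) K.refl ρ)))
        (specialise-lipschitz Φ Φ′ 0≤ε integral
          (λ (j , m) → ∣+∣≤ (integral (j , m)) (≤-trans (∣kXᵢᵈ∣≤ε j m) ε≤1))
          (λ (j , m) → ≤-respˡ-≈
            (trans (sym (∣-x∣≈∣x∣ _))
              (∣∣-cong (K.solve 2 (λ a b → K.:- b K.:= a K.:- (a K.:+ b))
                   K.refl (Φ (j , m)) ((K.- k j) K.* power i d m))))
            (∣kXᵢᵈ∣≤ε j m))
          Res)

    -- By homogeneity the factors yᵢᵈ and xᵢᵈ move into the arguments. The vectors yᵢ x and xᵢ y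
    -- have entries of size at most ‖x‖ ‖y‖, and their differences are 2 × 2 minors of x and y,
    -- hence at most `δ x y` times that size.
    evaluate-lipschitz : ∀ {x y} → ¬ IsZero K x → ¬ IsZero K y → ∀ i j →
      ∣ y i K.^ d K.* F x j K.- x i K.^ d K.* F y j ∣ ≤ δ x y * (‖ x ‖ * ‖ y ‖) ^ d
    evaluate-lipschitz {x} {y} x≢0 y≢0 i j = ≤-respˡ-≈
      (∣∣-cong (K.+-cong (form-scale e (y i) x) (K.-‿cong (form-scale e (x i) y))))
      (form-lipschitz e _ _ (λ m → integral (j , m))
        (*-nonneg (‖‖-nonneg x) (‖‖-nonneg y)) (δ-nonneg x≢0 y≢0)
        (λ l → ≤-respʳ-≈ (*-comm _ _) (∣*∣≤ (∣∣≤‖‖ y i) (∣∣≤‖‖ x l)))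
        (λ l → ∣*∣≤ (∣∣≤‖‖ x i) (∣∣≤‖‖ y l))
        (λ l → ≤-respʳ-≈ (sym (δ*‖x‖‖y‖≈wedge x≢0 y≢0)) (≤-respˡ-≈
          (∣∣-cong (K.+-cong (K.*-comm _ _) K.refl)) (minor≤wedge x y l i))))
      where
      e : Monomial (suc N) d → K.Carrier
      e m = Φ (j , m)

-- Two lifts of the same map differ by a constant factor

bounded : ∀ {n} (f : Fin n → ℕ) → ∃ λ M → ∀ i → f i ℕ.≤ M
bounded {zero}  f = 0 , λ ()
bounded {suc n} f with bounded (f ∘ suc)
... | M , f≤M = f zero ℕ.⊔ M , λ where
  zero    → ℕ.m≤m⊔n _ M
  (suc i) → ℕ.≤-trans (f≤M i) (ℕ.m≤n⊔m (f zero) M)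

module ProportionalPolynomials {c ℓ : Level} (K : Field c ℓ) where
  open Field K hiding (zero)
  open FieldProperties K
  open IntegerSolver commutativeRing
  open UnivariatePolynomials K
  open SetoidReasoning setoid

  Infinite : Set (c ⊔ˡ ℓ)
  Infinite = ∀ n → ∃ λ ts → n ℕ.≤ length ts × Distinct ts

  -- Nothing is known of `ratio` except that its values are roots of `p`. Since it does not depend
  -- on i, one frequently taken value k serves all pairs: each Fᵢ - k Gᵢ then has at least as many
  -- roots as coefficients.
  finite-ratio⇒constant : Infinite → ∀ p → horner p 0# ≉ 0# →
    ∀ {n} (F G : Fin n → Carrier → Carrier) → (∀ i → IsPolynomial (F i)) → (∀ i → IsPolynomial (G i)) →
    (ratio : Carrier → Carrier) → (∀ t → horner p (ratio t) ≈ 0#) →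
    (∀ i t → F i t ≈ ratio t * G i t) →
    ∃ λ k → ∀ i t → F i t ≈ k * G i t
  finite-ratio⇒constant infinite p p0≉0 F G F-poly G-poly ratio ratio-root F≈ratio*G
    with bounded (λ i → length (proj₁ (F-poly i)) ℕ.⊔ length (proj₁ (G-poly i)))
  -- `p` has at most `length p` roots, so this many samples force some value to be taken M times.
  ... | M , lengths≤M with infinite (length p ℕ.* M)
  ... | samples , enough , distinct
    with pigeonhole (length p) p ratio M samples ≡.refl p0≉0 distinct (All.universal ratio-root samples) enough
  ... | k , ts , M≤∣ts∣ , distinct′ , hits = k , F≈kG
    where
    difference : _ → List Carrier
    difference i = proj₁ (F-poly i) ⊞ List.map (- k *_) (proj₁ (G-poly i))

    horner-difference : ∀ i t → horner (difference i) t ≈ F i t + (- k) * G i t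
    horner-difference i t = trans (horner-⊞ (proj₁ (F-poly i)) _ t)
      (+-cong (sym (proj₂ (F-poly i) t))
              (trans (horner-scale (- k) (proj₁ (G-poly i)) t) (*-congˡ (sym (proj₂ (G-poly i) t)))))

    length-difference : ∀ i → length (difference i) ℕ.≤ length ts
    length-difference i = ℕ.≤-trans (ℕ.≤-reflexive (≡.trans (length-⊞ (proj₁ (F-poly i)) _)
        (≡.cong (length (proj₁ (F-poly i)) ℕ.⊔_) (List.length-map _ (proj₁ (G-poly i))))))
      (ℕ.≤-trans (lengths≤M i) M≤∣ts∣)

    difference-root : ∀ i {t} → ratio t ≈ k → horner (difference i) t ≈ 0#
    difference-root i {t} ratio≈k = begin
      horner (difference i) t            ≈⟨ horner-difference i t ⟩
      F i t + (- k) * G i t              ≈⟨ +-congʳ (F≈ratio*G i t) ⟩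
      ratio t * G i t + (- k) * G i t    ≈⟨ +-congʳ (*-congʳ ratio≈k) ⟩
      k * G i t + (- k) * G i t
        ≈⟨ solve 2 (λ k y → k :* y :+ (:- k) :* y := con (+ 0)) refl k (G i t) ⟩
      0#                                 ∎

    F≈kG : ∀ i t → F i t ≈ k * G i t
    F≈kG i t = x-y≈0⇒x≈y (begin
      F i t - k * G i t        ≈⟨ solve 3 (λ a k y → a :- k :* y := a :+ (:- k) :* y) refl (F i t) k (G i t) ⟩
      F i t + (- k) * G i t    ≈⟨ horner-difference i t ⟨
      horner (difference i) t  ≈⟨ roots-bound (difference i) ts (length-difference i) distinct′
                                    (All.map (difference-root i) hits) t ⟩
      0#                       ∎)

module ProportionalForms {c ℓ : Level} (K : Field c ℓ) (N d : ℕ) where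
  open Field K hiding (zero)
  open FieldProperties K
  open IntegerSolver commutativeRing
  open UnivariatePolynomials K
  open FormProperties K
  open ProportionalPolynomials K
  open SetoidReasoning setoid

  private
    V : Set c
    V = Vector Carrier (suc N)

    eval : Forms Carrier N (suc d) → V → V
    eval = evaluate commutativeRing

    pencil : (Φ Ψ : Forms Carrier N (suc d)) → Carrier → Forms Carrier N (suc d)
    pencil Φ Ψ t j = Φ j + (- t) * Ψ j

    pencil-isPolynomial : ∀ Φ Ψ j → IsPolynomial λ t → pencil Φ Ψ t j
    pencil-isPolynomial Φ Ψ j = +-isPolynomial (const-isPolynomial (Φ j))
      (*-isPolynomial (-‿isPolynomial id-isPolynomial) (const-isPolynomial (Ψ j)))

    eval-pencil : ∀ Φ Ψ t x i → eval (pencil Φ Ψ t) x i ≈ eval Φ x i + (- t) * eval Ψ x i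
    eval-pencil Φ Ψ t x i =
      form-linear {d = suc d} {e = λ m → pencil Φ Ψ t (i , m)} (- t) (λ m → refl) x

    -- The degree is positive, so homogeneity with factor zero applies. This covers lines that pass
    -- through the origin.
    eval-0 : ∀ Φ x → IsZero K x → IsZero K (eval Φ x)
    eval-0 Φ x x≡0 i = begin
      eval Φ x i                       ≈⟨ form-cong e (λ j → trans (x≡0 j) (sym (zeroˡ (x j)))) ⟩
      form e (λ j → 0# * x j)          ≈⟨ form-scale e 0# x ⟩
      0# * 0# ^ d * eval Φ x i         ≈⟨ *-congʳ (zeroˡ _) ⟩
      0# * eval Φ x i                  ≈⟨ zeroˡ _ ⟩
      0#                               ∎
      where
      e : Monomial (suc N) (suc d) → Carrier
      e m = Φ (i , m)

  -- Let Φ(x) = λ(x) Ψ(x).  The values of λ are roots of the polynomial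
  -- Res (Φ − t Ψ) in t, which is not zero since Res Φ ≠ 0; so there are finitely
  -- many of them.  On a line λ then takes some value k so often that Φ − k Ψ
  -- vanishes identically on that line, and λ is constant on it.
  constant-ratio :
    Infinite → ∀ (Res : Polynomial (Coefficient N (suc d))) →
    (∀ (Φ : Forms Carrier N (suc d)) → (specialise commutativeRing Φ Res ≈ 0#) ⇔ HasNontrivialZero K Φ) →
    ∀ Φ Ψ → ¬ HasNontrivialZero K Φ → ¬ HasNontrivialZero K Ψ →
    (∀ x → ¬ IsZero K x → ∃ λ k → ∀ i → eval Φ x i ≈ k * eval Ψ x i) →
    ∃ λ k → k ≉ 0# × ∀ x i → eval Φ x i ≈ k * eval Ψ x i
  constant-ratio infinite Res vanishing Φ Ψ Φ-nondegenerate Ψ-nondegenerate proportional =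
    ratio x₀ , ratio-x₀≉0 , constant
    where
    Res-pencil : IsPolynomial λ t → specialise commutativeRing (pencil Φ Ψ t) Res
    Res-pencil = specialise-isPolynomial (pencil Φ Ψ) (pencil-isPolynomial Φ Ψ) Res

    p = proj₁ Res-pencil

    p0≉0 : horner p 0# ≉ 0#
    p0≉0 p0≈0 = Φ-nondegenerate (proj₁ degenerate , proj₁ (proj₂ degenerate) , λ i → begin
      eval Φ (proj₁ degenerate) i              ≈⟨ eval-pencil-0 (proj₁ degenerate) i ⟨
      eval (pencil Φ Ψ 0#) (proj₁ degenerate) i ≈⟨ proj₂ (proj₂ degenerate) i ⟩
      0#                                       ∎)
      where
      degenerate : HasNontrivialZero K (pencil Φ Ψ 0#)
      degenerate = Equivalence.to (vanishing (pencil Φ Ψ 0#)) (trans (proj₂ Res-pencil 0#) p0≈0)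

      eval-pencil-0 : ∀ x i → eval (pencil Φ Ψ 0#) x i ≈ eval Φ x i
      eval-pencil-0 x i = trans (eval-pencil Φ Ψ 0# x i)
        (solve 2 (λ a b → a :+ (:- con (+ 0)) :* b := a) refl (eval Φ x i) (eval Ψ x i))

    x₀ : V
    x₀ _ = 1#

    x₀≢0 : ¬ IsZero K x₀
    x₀≢0 x₀≡0 = 1≉0 (x₀≡0 zero)

    Ratio : V → Set (c ⊔ˡ ℓ)
    Ratio x = ∃ λ k → horner p k ≈ 0# × ∀ i → eval Φ x i ≈ k * eval Ψ x i

    nonzero-ratio : ∀ x → ¬ IsZero K x → Ratio x
    nonzero-ratio x x≢0 = k , trans (sym (proj₂ Res-pencil k)) Res≈0 , Φx≈kΨx
      where
      k = proj₁ (proportional x x≢0)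
      Φx≈kΨx = proj₂ (proportional x x≢0)

      zero-x : IsZero K (eval (pencil Φ Ψ k) x)
      zero-x i = begin
        eval (pencil Φ Ψ k) x i                 ≈⟨ eval-pencil Φ Ψ k x i ⟩
        eval Φ x i + (- k) * eval Ψ x i         ≈⟨ +-congʳ (Φx≈kΨx i) ⟩
        k * eval Ψ x i + (- k) * eval Ψ x i
          ≈⟨ solve 2 (λ k y → k :* y :+ (:- k) :* y := con (+ 0)) refl k (eval Ψ x i) ⟩
        0#                                      ∎

      Res≈0 : specialise commutativeRing (pencil Φ Ψ k) Res ≈ 0#
      Res≈0 = Equivalence.from (vanishing (pencil Φ Ψ k)) (x , x≢0 , zero-x)

    -- At the origin both sides vanish and any scalar fits, but it must still be a root of `p`; the
    -- one found at `x₀` is borrowed.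
    zero-ratio : ∀ x → IsZero K x → Ratio x₀ → Ratio x
    zero-ratio x x≡0 (k , root , _) = k , root , λ i →
      trans (eval-0 Φ x x≡0 i) (sym (trans (*-congˡ (eval-0 Ψ x x≡0 i)) (zeroʳ k)))

    decide-ratio : ∀ x → Dec (IsZero K x) → Ratio x
    decide-ratio x (yes x≡0) = zero-ratio x x≡0 (nonzero-ratio x₀ x₀≢0)
    decide-ratio x (no  x≢0) = nonzero-ratio x x≢0

    ratioᵖ : ∀ x → Ratio x
    ratioᵖ x = decide-ratio x (Fin.all? λ i → x i ≟ 0#)

    ratio : V → Carrier
    ratio x = proj₁ (ratioᵖ x)

    Φ≈ratio*Ψ : ∀ x i → eval Φ x i ≈ ratio x * eval Ψ x i
    Φ≈ratio*Ψ x = proj₂ (proj₂ (ratioᵖ x))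

    Ψx₀≢0 : ¬ IsZero K (eval Ψ x₀)
    Ψx₀≢0 Ψx₀≡0 = Ψ-nondegenerate (x₀ , x₀≢0 , Ψx₀≡0)

    ratio-x₀≉0 : ratio x₀ ≉ 0#
    ratio-x₀≉0 ratio≈0 = Φ-nondegenerate (x₀ , x₀≢0 , λ i →
      trans (Φ≈ratio*Ψ x₀ i) (trans (*-congʳ ratio≈0) (zeroˡ _)))

    constant : ∀ x i → eval Φ x i ≈ ratio x₀ * eval Ψ x i
    constant x i = trans (Φx≈kΨx i) (*-congʳ k≈ratio)
      where
      -- Runs from `x₀` at t = 0 to x at t = 1, so the scalar valid along it links the two points.
      line : Carrier → V
      line t j = (1# - t) * x₀ j + t * x j

      on-line : (Ξ : Forms Carrier N (suc d)) → ∀ i → IsPolynomial λ t → eval Ξ (line t) i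
      on-line Ξ i = form-isPolynomial (λ m → Ξ (i , m)) (λ j t → line t j) λ j → +-isPolynomial
        (*-isPolynomial (+-isPolynomial (const-isPolynomial 1#) (-‿isPolynomial id-isPolynomial)) (const-isPolynomial (x₀ j)))
        (*-isPolynomial id-isPolynomial (const-isPolynomial (x j)))

      proportional-on-line : ∃ λ k → ∀ i t → eval Φ (line t) i ≈ k * eval Ψ (line t) i
      proportional-on-line = finite-ratio⇒constant infinite p p0≉0
        (λ i t → eval Φ (line t) i) (λ i t → eval Ψ (line t) i) (on-line Φ) (on-line Ψ) (ratio ∘ line)
        (λ t → proj₁ (proj₂ (ratioᵖ (line t)))) (λ i t → Φ≈ratio*Ψ (line t) i)

      k = proj₁ proportional-on-line
      Φ≈kΨ-on-line = proj₂ proportional-on-line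

      through : ∀ t z → (∀ j → line t j ≈ z j) → ∀ i → eval Φ z i ≈ k * eval Ψ z i
      through t z line≈z i = begin
        eval Φ z i             ≈⟨ form-cong (λ m → Φ (i , m)) line≈z ⟨
        eval Φ (line t) i      ≈⟨ Φ≈kΨ-on-line i t ⟩
        k * eval Ψ (line t) i  ≈⟨ *-congˡ (form-cong (λ m → Ψ (i , m)) line≈z) ⟩
        k * eval Ψ z i         ∎

      Φx≈kΨx : ∀ i → eval Φ x i ≈ k * eval Ψ x i
      Φx≈kΨx = through 1# x λ j →
        solve 2 (λ a b → (con (+ 1) :- con (+ 1)) :* a :+ con (+ 1) :* b := b) refl (x₀ j) (x j)

      Φx₀≈kΨx₀ : ∀ i → eval Φ x₀ i ≈ k * eval Ψ x₀ i
      Φx₀≈kΨx₀ = through 0# x₀ λ j →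
        solve 2 (λ a b → (con (+ 1) :- con (+ 0)) :* a :+ con (+ 0) :* b := a) refl (x₀ j) (x j)

      -- `Ψ` does not vanish at `x₀`, so the scalar there is unique; this makes the scalars of all
      -- lines agree.
      k≈ratio : k ≈ ratio x₀
      k≈ratio = decidable-stable (k ≟ ratio x₀) λ k≉ratio → Ψx₀≢0 λ i →
        x≉0∧xy≈0⇒y≈0 (k≉ratio ∘ x-y≈0⇒x≈y) (begin
          (k - ratio x₀) * eval Ψ x₀ i
            ≈⟨ solve 3 (λ k r y → (k :- r) :* y := k :* y :- r :* y)
                 refl k (ratio x₀) (eval Ψ x₀ i) ⟩
          k * eval Ψ x₀ i - ratio x₀ * eval Ψ x₀ i ≈⟨ +-cong (Φx₀≈kΨx₀ i) (-‿cong (Φ≈ratio*Ψ x₀ i)) ⟨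
          eval Φ x₀ i - eval Φ x₀ i                ≈⟨ -‿inverseʳ _ ⟩
          0#                                       ∎)

module _ {r r₁ r₂ c ℓ : Level} {ℝ : RealNumbers r r₁ r₂} {K : Field c ℓ}
         (v : NonarchimedeanAbsoluteValue ℝ K) where
  open RealNumbers ℝ hiding (zero)
  open RealProperties ℝ hiding (∣∣-cong)
  open NonarchimedeanAbsoluteValue v
  open AbsoluteValueProperties v
  open ProportionalPolynomials K using (Infinite)
  open ≤-Reasoning
  private
    module K where
      open Field K public
      open FieldProperties K public

  private
    large : Nontrivial → ∃ λ z → 1# < ∣ z ∣
    large (z , z≉0 , ∣z∣≉1) with x≤y⊎y<x (∣ z ∣) 1#
    ... | inj₂ 1<∣z∣ = z , 1<∣z∣
    ... | inj₁ ∣z∣≤1 = z K.⁻¹ , (begin-strict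
      1#                     ≈⟨ ∣1∣≈1 ⟨
      ∣ K.1# ∣               ≈⟨ ∣∣-cong (K.⁻¹-inverseˡ z≉0) ⟨
      ∣ z K.⁻¹ K.* z ∣       ≈⟨ ∣∣-* _ _ ⟩
      ∣ z K.⁻¹ ∣ * ∣ z ∣     <⟨ *-monoʳ-< (x≉0⇒0<∣x∣ (K.⁻¹-≉0 z≉0)) (∣z∣≤1 , ∣z∣≉1) ⟩
      ∣ z K.⁻¹ ∣ * 1#        ≈⟨ *-identityʳ _ ⟩
      ∣ z K.⁻¹ ∣             ∎)

  -- The powers of an element of absolute value above one are told apart by their absolute values.
  nontrivial⇒infinite : Nontrivial → Infinite
  nontrivial⇒infinite nontrivial n with large nontrivial
  ... | z , 1<∣z∣ = List.applyUpTo (z K.^_) n , ℕ.≤-reflexive (≡.sym (List.length-applyUpTo _ n)) ,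
    AllPairs.applyUpTo⁺₁ _ n λ {i} {j} i<j _ zⁱ≈zʲ →
      proj₂ (^-mono-< 1<∣z∣ i<j) (trans (sym (∣^∣ z i)) (trans (∣∣-cong zⁱ≈zʲ) (∣^∣ z j)))

-- Local constancy of the norm ratio and expansion of the chordal distance

fold-commute : ∀ {a} {A : Set a} (f : A → A) x n → fold (f x) f n ≡ f (fold x f n)
fold-commute f x zero    = ≡.refl
fold-commute f x (suc n) = ≡.cong f (fold-commute f x n)

module QuasiHomogeneousMaps {r r₁ r₂ c ℓ : Level} {ℝ : RealNumbers r r₁ r₂} {K : Field c ℓ}
                            (v : NonarchimedeanAbsoluteValue ℝ K) (N d : ℕ) where
  open RealNumbers ℝ hiding (zero)
  open RealProperties ℝ hiding (∣∣-cong)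
  open NonarchimedeanAbsoluteValue v
  open AbsoluteValueProperties v
  open NormProperties v N
  open Dynamics v N
  open ≤-Reasoning
  private
    module K where
      open Field K public
      open FieldProperties K public
      open IntegerSolver (Field.commutativeRing K) public

    V : Set c
    V = Vector K.Carrier (suc N)

  δ-sym : ∀ x y → δ x y ≈ δ y x
  δ-sym x y = *-cong (antisym (wedge-≤ x y) (wedge-≤ y x)) (⁻¹-cong (*-comm ‖ x ‖ ‖ y ‖))
    where
    wedge-≤ : ∀ x y → wedge x y ≤ wedge y x
    wedge-≤ x y = wedge-lub x y (wedge-nonneg y x) λ i j → ≤-respˡ-≈
      (∣∣-cong (K.+-cong (K.*-comm _ _) (K.-‿cong (K.*-comm _ _)))) (minor≤wedge y x j i)

  -- For a minimal lift Ψ one has k = 1 and R = |Res φ|, and for κ Ψ the same R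
  -- and k = |κ|.
  record Bounds (F : V → V) (k R : Carrier) : Set (c ⊔ˡ ℓ ⊔ˡ r₁ ⊔ˡ r₂) where
    field
      0<k       : 0# < k
      0<R       : 0# < R
      R≤1       : R ≤ 1#
      nonzero   : ∀ {x} → ¬ IsZero K x → ¬ IsZero K (F x)
      upper     : ∀ x → ‖ F x ‖ ≤ k * ‖ x ‖ ^ d
      lower     : ∀ x → ¬ IsZero K x → k * (R * ‖ x ‖ ^ d) ≤ ‖ F x ‖
      lipschitz : ∀ {x y} → ¬ IsZero K x → ¬ IsZero K y → ∀ i j →
        ∣ y i K.^ d K.* F x j K.- x i K.^ d K.* F y j ∣ ≤ k * (δ x y * (‖ x ‖ * ‖ y ‖) ^ d)

  module Estimates {F : V → V} {k R : Carrier} (bounds : Bounds F k R) where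
    open Bounds bounds

    module _ {x y : V} (x≢0 : ¬ IsZero K x) (y≢0 : ¬ IsZero K y) where
      private
        s = ‖ x ‖ ^ d
        t = ‖ y ‖ ^ d
        0<s = ^-positive d (‖‖-positive x≢0)
        0<t = ^-positive d (‖‖-positive y≢0)

        [‖x‖‖y‖]ᵈ≈st : (‖ x ‖ * ‖ y ‖) ^ d ≈ s * t
        [‖x‖‖y‖]ᵈ≈st = ^-distrib-* ‖ x ‖ ‖ y ‖ d

        ∣ᵈ∣≈ : ∀ (x : V) i → ∣ x i ∣ ≈ ‖ x ‖ → ∣ x i K.^ d ∣ ≈ ‖ x ‖ ^ d
        ∣ᵈ∣≈ x i attained = trans (∣^∣ (x i) d) (^-congˡ d attained)

        ∣ᵈ∣≤ : ∀ (x : V) i → ∣ x i K.^ d ∣ ≤ ‖ x ‖ ^ d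
        ∣ᵈ∣≤ x i = ≤-respˡ-≈ (sym (∣^∣ (x i) d)) (^-mono-≤ d (nonneg (x i)) (∣∣≤‖‖ x i))

      -- The indices make `a` as large as the left-hand side. By `lipschitz` and `lower`, `a` and
      -- `b` differ by less than |a|, so b cannot be smaller. Exchanging x and y gives the opposite
      -- inequality.
      locally-constant : δ x y < R → ‖ y ‖ ^ d * ‖ F x ‖ ≤ ‖ x ‖ ^ d * ‖ F y ‖
      locally-constant δ<R = begin
        t * ‖ F x ‖                     ≈⟨ ∣a∣≈ ⟨
        ∣ a ∣                           ≤⟨ ∣x-y∣<∣x∣⇒∣x∣≤∣y∣ ∣a-b∣<∣a∣ ⟩
        ∣ b ∣                           ≤⟨ ∣*∣≤ (∣ᵈ∣≤ x i) (∣∣≤‖‖ (F y) j) ⟩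
        s * ‖ F y ‖                     ∎
        where
        i = proj₁ (‖‖-attained y)
        j = proj₁ (‖‖-attained (F x))
        a = y i K.^ d K.* F x j
        b = x i K.^ d K.* F y j

        ∣a∣≈ : ∣ a ∣ ≈ t * ‖ F x ‖
        ∣a∣≈ = trans (∣∣-* _ _) (*-cong (∣ᵈ∣≈ y i (proj₂ (‖‖-attained y))) (proj₂ (‖‖-attained (F x))))

        ∣a-b∣<∣a∣ : ∣ a K.- b ∣ < ∣ a ∣
        ∣a-b∣<∣a∣ = begin-strict
          ∣ a K.- b ∣                          ≤⟨ lipschitz x≢0 y≢0 i j ⟩
          k * (δ x y * (‖ x ‖ * ‖ y ‖) ^ d)    ≈⟨ *-congˡ (*-congˡ [‖x‖‖y‖]ᵈ≈st) ⟩
          k * (δ x y * (s * t))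
            ≈⟨ solve 4 (λ k δ s t → k :* (δ :* (s :* t)) := k :* (s :* t) :* δ) refl k (δ x y) s t ⟩
          k * (s * t) * δ x y                  <⟨ *-monoʳ-< (*-positive 0<k (*-positive 0<s 0<t)) δ<R ⟩
          k * (s * t) * R
            ≈⟨ solve 4 (λ k s t R → k :* (s :* t) :* R := t :* (k :* (R :* s))) refl k s t R ⟩
          t * (k * (R * s))                    ≤⟨ *-monoʳ-≤ (proj₁ 0<t) (lower x x≢0) ⟩
          t * ‖ F x ‖                          ≈⟨ ∣a∣≈ ⟨
          ∣ a ∣                                ∎

      -- Multiply a minor of F x and F y by xᵢᵈ and replace xᵢᵈ F(y) by yᵢᵈ F(x). The main terms
      -- form a minor of F x with itself and cancel; the errors are controlled by `lipschitz`. With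
      -- |xᵢ| = ‖x‖ the multiplier can be divided out again.
      wedge-bound : wedge (F x) (F y) ≤ k * k * (s * t) * δ x y
      wedge-bound = wedge-lub (F x) (F y) 0≤bound λ j l → *-cancelˡ-≤ 0<s (begin
        s * ∣ P j K.* Q l K.- P l K.* Q j ∣
          ≈⟨ *-congʳ (∣ᵈ∣≈ x i (proj₂ (‖‖-attained x))) ⟨
        ∣ x i K.^ d ∣ * ∣ P j K.* Q l K.- P l K.* Q j ∣
          ≈⟨ ∣∣-* _ _ ⟨
        ∣ x i K.^ d K.* (P j K.* Q l K.- P l K.* Q j) ∣
          ≈⟨ ∣∣-cong (K.solve 6 (λ X Y Pj Pl Qj Ql →
               X K.:* (Pj K.:* Ql K.:- Pl K.:* Qj) K.:=
               Pl K.:* (Y K.:* Pj K.:- X K.:* Qj) K.:- Pj K.:* (Y K.:* Pl K.:- X K.:* Ql))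
               K.refl (x i K.^ d) (y i K.^ d) (P j) (P l) (Q j) (Q l)) ⟩
        ∣ P l K.* e j K.- P j K.* e l ∣
          ≤⟨ ∣-∣≤ (∣Pe∣≤ l j) (∣Pe∣≤ j l) ⟩
        k * s * (k * (δ x y * (‖ x ‖ * ‖ y ‖) ^ d))
          ≈⟨ *-congˡ (*-congˡ (*-congˡ [‖x‖‖y‖]ᵈ≈st)) ⟩
        k * s * (k * (δ x y * (s * t)))
          ≈⟨ solve 4 (λ k δ s t → k :* s :* (k :* (δ :* (s :* t))) := s :* (k :* k :* (s :* t) :* δ))
               refl k (δ x y) s t ⟩
        s * (k * k * (s * t) * δ x y) ∎)
        where
        P = F x
        Q = F y
        i = proj₁ (‖‖-attained x)
        e : Fin (suc N) → K.Carrier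
        e j = y i K.^ d K.* P j K.- x i K.^ d K.* Q j

        0≤bound : 0# ≤ k * k * (s * t) * δ x y
        0≤bound = *-nonneg (proj₁ (*-positive (*-positive 0<k 0<k) (*-positive 0<s 0<t))) (δ-nonneg x≢0 y≢0)

        ∣Pe∣≤ : ∀ j l → ∣ P j K.* e l ∣ ≤ k * s * (k * (δ x y * (‖ x ‖ * ‖ y ‖) ^ d))
        ∣Pe∣≤ j l = ∣*∣≤ (≤-trans (∣∣≤‖‖ P j) (upper x)) (lipschitz x≢0 y≢0 i l)

      -- Each of the two norms in the denominator of the new distance may be smaller by a factor R,
      -- hence the square. The scale k enters numerator and denominator alike and cancels.
      expansion : R ^ 2 * δ (F x) (F y) ≤ δ x y
      expansion = *-cancelˡ-≤ (*-positive (*-positive 0<k 0<k) (*-positive 0<s 0<t)) (begin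
        k * k * (s * t) * (R ^ 2 * δF)
          ≈⟨ solve 5 (λ k s t R δ → k :* k :* (s :* t) :* (R :* (R :* con (+ 1)) :* δ) :=
                 δ :* (k :* (R :* s) :* (k :* (R :* t))))
               refl k s t R δF ⟩
        δF * (k * (R * s) * (k * (R * t)))
          ≤⟨ *-monoʳ-≤ (δ-nonneg Fx≢0 Fy≢0) (*-mono₂-≤ 0≤kRs (‖‖-nonneg (F y)) (lower x x≢0) (lower y y≢0)) ⟩
        δF * (‖ F x ‖ * ‖ F y ‖)                  ≈⟨ δ*‖x‖‖y‖≈wedge Fx≢0 Fy≢0 ⟩
        wedge (F x) (F y)                         ≤⟨ wedge-bound ⟩
        k * k * (s * t) * δ x y                   ∎)
        where
        δF = δ (F x) (F y)
        Fx≢0 = nonzero x≢0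
        Fy≢0 = nonzero y≢0

        0≤kRs : 0# ≤ k * (R * s)
        0≤kRs = *-nonneg (proj₁ 0<k) (*-nonneg (proj₁ 0<R) (proj₁ 0<s))

-- The modified Green function: oscillation, functional equation and scaling

module GreenFunctionEstimates
  {r r₁ r₂ c ℓ : Level} {ℝ : RealNumbers r r₁ r₂} {K : Field c ℓ}
  (v : NonarchimedeanAbsoluteValue ℝ K) (N d : ℕ) (2≤d : 2 ℕ.≤ d)
  {F : Vector (Field.Carrier K) (suc N) → Vector (Field.Carrier K) (suc N)}
  {k R : RealNumbers.Carrier ℝ} (bounds : QuasiHomogeneousMaps.Bounds v N d F k R)
  (G : Vector (Field.Carrier K) (suc N) → RealNumbers.Carrier ℝ)
  (green : ∀ x → ¬ IsZero K x →
    RealNumbers.ConvergesTo ℝ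
      (λ n → RealNumbers._/_ ℝ (RealNumbers.log ℝ (Dynamics.‖_‖ v N (fold x F n)))
                              (RealNumbers._^_ ℝ (RealNumbers.ι ℝ d) n))
      (G x))
  where
  open RealNumbers ℝ hiding (zero)
  open RealProperties ℝ hiding (∣∣-cong)
  open ExpLog ℝ
  open Limits ℝ
  open NormProperties v N
  open Dynamics v N using (‖_‖)
  open QuasiHomogeneousMaps v N d
  open Bounds bounds
  open Estimates bounds
  open ≤-Reasoning

  private
    V : Set c
    V = Vector (Field.Carrier K) (suc N)

    D : Carrier
    D = ι d

    2≤D : ι 2 ≤ D
    2≤D = ι-mono-≤ 2≤d

    1<D : 1# < D
    1<D = <-≤-trans 1<2 2≤D
      where
      1<2 : 1# < ι 2
      1<2 = 0<y-x⇒x<y (<-≤-trans (ι-positive 0) (≤-reflexive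
        (solve 1 (λ o → o :+ con (+ 0) := (o :+ (o :+ con (+ 0))) :- o) refl 1#)))

    0<D : 0# < D
    0<D = <-trans 0<1 1<D

    Dⁿ>0 : ∀ n → 0# < D ^ n
    Dⁿ>0 n = ^-positive n 0<D

    L : V → Carrier
    L x = log ‖ x ‖

    -- The length of an interval containing all values of log ‖F x‖ - d log ‖x‖; the scale k only
    -- translates this interval.
    ℓᴿ : Carrier
    ℓᴿ = - log R

    0≤ℓᴿ : 0# ≤ ℓᴿ
    0≤ℓᴿ = ≤-respˡ-≈ (solve 0 (:- con (+ 0) := con (+ 0)) refl)
      (-‿anti-≤ (≤-respʳ-≈ log-1 (log-mono-≤ 0<R R≤1)))

    iterate≢0 : ∀ {x} n → ¬ IsZero K x → ¬ IsZero K (fold x F n)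
    iterate≢0 zero    x≢0 = x≢0
    iterate≢0 (suc n) x≢0 = nonzero (iterate≢0 n x≢0)

    log-^-D : ∀ {x} → ¬ IsZero K x → log (‖ x ‖ ^ d) ≈ D * L x
    log-^-D x≢0 = log-^ d (‖‖-positive x≢0)

    L-upper : ∀ {x} → ¬ IsZero K x → L (F x) ≤ log k + D * L x
    L-upper {x} x≢0 = begin
      L (F x)                   ≤⟨ log-mono-≤ (‖‖-positive (nonzero x≢0)) (upper x) ⟩
      log (k * ‖ x ‖ ^ d)       ≈⟨ log-* 0<k (^-positive d (‖‖-positive x≢0)) ⟩
      log k + log (‖ x ‖ ^ d)   ≈⟨ +-congˡ (log-^-D x≢0) ⟩
      log k + D * L x           ∎

    L-lower : ∀ {x} → ¬ IsZero K x → log k + (log R + D * L x) ≤ L (F x)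
    L-lower {x} x≢0 = begin
      log k + (log R + D * L x)            ≈⟨ +-congˡ (+-congˡ (log-^-D x≢0)) ⟨
      log k + (log R + log (‖ x ‖ ^ d))    ≈⟨ +-congˡ (log-* 0<R 0<s) ⟨
      log k + log (R * ‖ x ‖ ^ d)          ≈⟨ log-* 0<k (*-positive 0<R 0<s) ⟨
      log (k * (R * ‖ x ‖ ^ d))            ≤⟨ log-mono-≤ (*-positive 0<k (*-positive 0<R 0<s)) (lower x x≢0) ⟩
      L (F x)                              ∎
      where
      0<s = ^-positive d (‖‖-positive x≢0)

    L-step : ∀ {x y} → ¬ IsZero K x → ¬ IsZero K y → L (F x) - L (F y) ≤ D * (L x - L y) + ℓᴿ
    L-step {x} {y} x≢0 y≢0 = begin
      L (F x) - L (F y)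
        ≤⟨ +-mono₂-≤ (L-upper x≢0) (-‿anti-≤ (L-lower y≢0)) ⟩
      (log k + D * L x) - (log k + (log R + D * L y))
        ≈⟨ solve 5 (λ k D x R y → (k :+ D :* x) :- (k :+ (R :+ D :* y)) := D :* (x :- y) :+ (:- R))
             refl (log k) D (L x) (log R) (L y) ⟩
      D * (L x - L y) + ℓᴿ                                     ∎

    -- Summing the geometric series would give the coefficient d (dⁿ - 1)/(d - 1). Replacing d/(d -
    -- 1) by 2 avoids the quotient and is where the factor 2 of the final constant originates.
    L-iterate : ∀ {x y} → ¬ IsZero K x → ¬ IsZero K y → ∀ n →
      D * (L (fold x F n) - L (fold y F n)) ≤ D ^ n * (D * (L x - L y)) + ι 2 * (D ^ n - 1#) * ℓᴿ
    L-iterate {x} {y} x≢0 y≢0 zero = ≤-reflexive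
      (solve 4 (λ D l i ℓ → D :* l := con (+ 1) :* (D :* l) :+ i :* (con (+ 1) :- con (+ 1)) :* ℓ)
           refl D (L x - L y) (ι 2) ℓᴿ)
    L-iterate {x} {y} x≢0 y≢0 (suc n) = begin
      D * (L (F X) - L (F Y))
        ≤⟨ *-monoʳ-≤ (proj₁ 0<D) (L-step (iterate≢0 n x≢0) (iterate≢0 n y≢0)) ⟩
      D * (D * (L X - L Y) + ℓᴿ)
        ≤⟨ *-monoʳ-≤ (proj₁ 0<D) (+-mono-≤ ℓᴿ (L-iterate x≢0 y≢0 n)) ⟩
      D * ((D ^ n * (D * (L x - L y)) + ι 2 * (D ^ n - 1#) * ℓᴿ) + ℓᴿ)
        -- The slack is exactly (d - 2) times `ℓᴿ`, nonnegative as d ≥ 2.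
        ≤⟨ ≤-by (*-nonneg (x≤y⇒0≤y-x 2≤D) 0≤ℓᴿ) (solve 4 (λ D p l ℓ →
             (D :- two) :* ℓ :=
             ((D :* p) :* (D :* l) :+ two :* (D :* p :- con (+ 1)) :* ℓ) :-
             (D :* ((p :* (D :* l) :+ two :* (p :- con (+ 1)) :* ℓ) :+ ℓ))) refl D (D ^ n) (L x - L y) ℓᴿ) ⟩
      D ^ suc n * (D * (L x - L y)) + ι 2 * (D ^ suc n - 1#) * ℓᴿ
        ∎
      where
      X = fold x F n
      Y = fold y F n
      two = con (+ 1) :+ (con (+ 1) :+ con (+ 0))

  ĝ : V → Carrier
  ĝ x = G x - L x

  -- After division by dⁿ the bound of `L-iterate` no longer depends on n, so it survives in the
  -- limit.
  ĝ-oscillation : ∀ {x y} → ¬ IsZero K x → ¬ IsZero K y → D * (ĝ x - ĝ y) ≤ ι 2 * ℓᴿ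
  ĝ-oscillation {x} {y} x≢0 y≢0 = begin
    D * ((G x - L x) - (G y - L y))
      ≈⟨ solve 5 (λ D gx lx gy ly → D :* ((gx :- lx) :- (gy :- ly)) :=
             (D :* gx :- D :* gy) :- D :* (lx :- ly))
           refl D (G x) (L x) (G y) (L y) ⟩
    (D * G x - D * G y) - D * (L x - L y)
      ≤⟨ +-mono-≤ _ (lim-≤ (lim-* 0<D (green x x≢0)) (lim-* 0<D (green y y≢0)) approximants) ⟩
    (D * (L x - L y) + ι 2 * ℓᴿ) - D * (L x - L y)
      ≈⟨ solve 2 (λ a b → (a :+ b) :- a := b) refl (D * (L x - L y)) (ι 2 * ℓᴿ) ⟩
    ι 2 * ℓᴿ                                     ∎
    where
    approximants : ∀ n → D * (L (fold x F n) / D ^ n) - D * (L (fold y F n) / D ^ n) ≤ D * (L x - L y) + ι 2 * ℓᴿ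
    approximants n = *-cancelˡ-≤ (Dⁿ>0 n) (begin
      p * (D * (lx * q) - D * (ly * q))
        ≈⟨ solve 5 (λ p q D lx ly → p :* (D :* (lx :* q) :- D :* (ly :* q)) := (p :* q) :* (D :* (lx :- ly)))
             refl p q D lx ly ⟩
      p * q * (D * (lx - ly))                          ≈⟨ *-congʳ (⁻¹-inverseʳ (0<⇒≉0 (Dⁿ>0 n))) ⟩
      1# * (D * (lx - ly))                             ≈⟨ *-identityˡ _ ⟩
      D * (lx - ly)                                    ≤⟨ L-iterate x≢0 y≢0 n ⟩
      p * (D * (L x - L y)) + ι 2 * (p - 1#) * ℓᴿ
        ≤⟨ ≤-by (*-nonneg (ι-nonneg 2) 0≤ℓᴿ) (solve 4 (λ p l i ℓ → i :* ℓ :=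
               p :* (l :+ i :* ℓ) :- (p :* l :+ i :* (p :- con (+ 1)) :* ℓ))
             refl p (D * (L x - L y)) (ι 2) ℓᴿ) ⟩
      p * (D * (L x - L y) + ι 2 * ℓᴿ)                 ∎)
      where
      p = D ^ n
      q = (D ^ n) ⁻¹
      lx = L (fold x F n)
      ly = L (fold y F n)

  -- The sequence defining `G (F x)` is d times the shifted sequence defining `G x`.
  G-functional-equation : ∀ {x} → ¬ IsZero K x → G (F x) ≈ D * G x
  G-functional-equation {x} x≢0 =
    lim-unique (green (F x) (nonzero x≢0)) (lim-* 0<D (lim-suc (green x x≢0))) λ n →
      *-cancelˡ (0<⇒≉0 (Dⁿ>0 n)) (begin-equality
        D ^ n * (L (fold (F x) F n) / D ^ n)           ≈⟨ *-/-cancel (Dⁿ>0 n) ⟩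
        L (fold (F x) F n)                             ≡⟨ ≡.cong L (fold-commute F x n) ⟩
        L (fold x F (suc n))                           ≈⟨ *-/-cancel (Dⁿ>0 (suc n)) ⟨
        D ^ suc n * (L (fold x F (suc n)) / D ^ suc n)
          ≈⟨ solve 3 (λ D p l → D :* p :* l := p :* (D :* l))
               refl D (D ^ n) (L (fold x F (suc n)) / D ^ suc n) ⟩
        D ^ n * (D * (L (fold x F (suc n)) / D ^ suc n)) ∎)
    where
    *-/-cancel : ∀ {a b} → 0# < b → b * (a / b) ≈ a
    *-/-cancel 0<b = trans (*-comm _ _) (/-cancel (0<⇒≉0 0<b))

  -- `G` scales exactly by d, so only the terms log ‖F x‖ - d log ‖x‖ at the two points could
  -- interfere; local constancy compares them.
  ĝ-step : ∀ {x y} → ¬ IsZero K x → ¬ IsZero K y → δ x y < R →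
           D * (ĝ x - ĝ y) ≤ ĝ (F x) - ĝ (F y)
  ĝ-step {x} {y} x≢0 y≢0 δ<R = ≤-by (x≤y⇒0≤y-x logs) (begin-equality
    (D * L x + L (F y)) - (D * L y + L (F x))
      ≈⟨ solve 7 (λ D gx gy lx ly lx′ ly′ → (D :* lx :+ ly′) :- (D :* ly :+ lx′) :=
           ((D :* gx :- lx′) :- (D :* gy :- ly′)) :- D :* ((gx :- lx) :- (gy :- ly)))
           refl D (G x) (G y) (L x) (L y) (L (F x)) (L (F y)) ⟩
    ((D * G x - L (F x)) - (D * G y - L (F y))) - D * (ĝ x - ĝ y)
      ≈⟨ +-congʳ (+-cong (+-congʳ (G-functional-equation x≢0)) (-‿cong (+-congʳ (G-functional-equation y≢0)))) ⟨
    (ĝ (F x) - ĝ (F y)) - D * (ĝ x - ĝ y)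
      ∎)
    where
    log-product : ∀ {x y} → ¬ IsZero K x → ¬ IsZero K y → log (‖ x ‖ ^ d * ‖ F y ‖) ≈ D * L x + L (F y)
    log-product x≢0 y≢0 = trans (log-* (^-positive d (‖‖-positive x≢0)) (‖‖-positive (nonzero y≢0)))
                                (+-congʳ (log-^-D x≢0))

    logs : D * L y + L (F x) ≤ D * L x + L (F y)
    logs = ≤-respˡ-≈ (log-product y≢0 x≢0) (≤-respʳ-≈ (log-product x≢0 y≢0)
      (log-mono-≤ (*-positive (^-positive d (‖‖-positive y≢0)) (‖‖-positive (nonzero x≢0)))
                  (locally-constant x≢0 y≢0 δ<R)))

  -- Distance zero persists along the orbits, so `ĝ-step` applies indefinitely, and all multiples of
  -- the difference by powers of d obey one oscillation bound. In particular the value of ĝ does not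
  -- depend on the representative.
  ĝ-degenerate : ∀ {x y} → ¬ IsZero K x → ¬ IsZero K y → δ x y ≈ 0# → ĝ x - ĝ y ≤ 0#
  ĝ-degenerate {x} {y} x≢0 y≢0 δ≈0 with x≤y⊎y<x (ĝ x - ĝ y) 0#
  ... | inj₁ ĝx-ĝy≤0 = ĝx-ĝy≤0
  ... | inj₂ 0<ĝx-ĝy = ι-bounded⇒≤0 (ι 2 * ℓᴿ) λ n → begin
      ι n * (ĝ x - ĝ y)        ≤⟨ *-monoˡ-≤ (proj₁ 0<ĝx-ĝy) (≤-trans (ι≤^ n 2≤D) (^≤^suc n)) ⟩
      D ^ suc n * (ĝ x - ĝ y)  ≤⟨ bounded-multiple n x≢0 y≢0 δ≈0 ⟩
      ι 2 * ℓᴿ                 ∎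
    where
    ^≤^suc : ∀ n → D ^ n ≤ D ^ suc n
    ^≤^suc n = ≤-respˡ-≈ (*-identityˡ _) (*-monoˡ-≤ (proj₁ (Dⁿ>0 n)) (proj₁ 1<D))

    bounded-multiple : ∀ n {x y} → ¬ IsZero K x → ¬ IsZero K y → δ x y ≈ 0# →
                       D ^ suc n * (ĝ x - ĝ y) ≤ ι 2 * ℓᴿ
    bounded-multiple zero    x≢0 y≢0 δ≈0 = ≤-respˡ-≈ (*-congʳ (sym (*-identityʳ D))) (ĝ-oscillation x≢0 y≢0)
    bounded-multiple (suc n) {x} {y} x≢0 y≢0 δ≈0 = begin
      D ^ suc (suc n) * (ĝ x - ĝ y)
        ≈⟨ solve 3 (λ D p g → D :* p :* g := p :* (D :* g)) refl D (D ^ suc n) (ĝ x - ĝ y) ⟩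
      D ^ suc n * (D * (ĝ x - ĝ y))
        ≤⟨ *-monoʳ-≤ (proj₁ (Dⁿ>0 (suc n))) (ĝ-step x≢0 y≢0 (≤-<-trans (≤-reflexive δ≈0) 0<R)) ⟩
      D ^ suc n * (ĝ (F x) - ĝ (F y))    ≤⟨ bounded-multiple n (nonzero x≢0) (nonzero y≢0) δF≈0 ⟩
      ι 2 * ℓᴿ                           ∎
      where
      δF≈0 : δ (F x) (F y) ≈ 0#
      δF≈0 = antisym
        (*-cancelˡ-≤ (^-positive 2 0<R)
          (≤-trans (expansion x≢0 y≢0) (≤-reflexive (trans δ≈0 (sym (zeroʳ _))))))
        (δ-nonneg (nonzero x≢0) (nonzero y≢0))

  -- The Hölder estimate with its exponent and constant

  module Exponent (u : Carrier) (2D≤u : ι 2 * D ≤ u) (1≤uR² : 1# ≤ u * R ^ 2) where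
    α C : Carrier
    α = log D / log u
    C = ι 2 * u * log u / D

    D≤u : D ≤ u
    D≤u = ≤-trans (≤-by (proj₁ 0<D) (solve 1 (λ D → D := (con (+ 1) :+ (con (+ 1) :+ con (+ 0))) :* D :- D)
         refl D)) 2D≤u

    1<u : 1# < u
    1<u = <-≤-trans 1<D D≤u

    0<u : 0# < u
    0<u = <-trans 0<1 1<u

    0<α : 0# < α
    0<α = /-positive (log-positive 1<D) (log-positive 1<u)

    α≤1 : α ≤ 1#
    α≤1 = /-≤ (log-positive 1<u) (≤-respʳ-≈ (sym (*-identityˡ _)) (log-mono-≤ 0<D D≤u))

    0<C : 0# < C
    0<C = /-positive (*-positive (*-positive (ι-positive 1) 0<u) (log-positive 1<u)) 0<D

    private
      1≤uR : 1# ≤ u * R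
      1≤uR = ≤-trans 1≤uR² (*-monoʳ-≤ (proj₁ 0<u)
        (≤-respʳ-≈ (*-identityʳ R) (*-monoʳ-≤ (proj₁ 0<R) (≤-respˡ-≈ (sym (*-identityʳ R)) R≤1))))

      ℓᴿ≤log-u : ℓᴿ ≤ log u
      ℓᴿ≤log-u = ≤-by (log-nonneg 1≤uR) (trans (log-* 0<u 0<R)
        (solve 2 (λ a b → a :+ b := a :- (:- b)) refl (log u) (log R)))

      uε^α : ∀ {ε} → 0# < ε → (u * ε) ^ᴿ α ≈ D * ε ^ᴿ α
      uε^α 0<ε = trans (^ᴿ-distrib-* α 0<u 0<ε) (*-congʳ (^ᴿ-log/log 1<u 0<D))

      -- At distances of at least R the oscillation bound alone is enough; the size of `C` is chosen
      -- for this case.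
      ĝ-far : ∀ {x y ε} → ¬ IsZero K x → ¬ IsZero K y → R ≤ ε → ĝ x - ĝ y ≤ C * ε ^ᴿ α
      ĝ-far {x} {y} {ε} x≢0 y≢0 R≤ε = *-cancelˡ-≤ 0<D (begin
        D * (ĝ x - ĝ y)                   ≤⟨ ĝ-oscillation x≢0 y≢0 ⟩
        ι 2 * ℓᴿ                          ≤⟨ *-monoʳ-≤ (ι-nonneg 2) ℓᴿ≤log-u ⟩
        ι 2 * log u                       ≈⟨ *-identityʳ _ ⟨
        ι 2 * log u * 1#
          ≤⟨ *-monoʳ-≤ (*-nonneg (ι-nonneg 2) (log-nonneg (proj₁ 1<u))) 1≤uε^α ⟩
        ι 2 * log u * (u * ε ^ᴿ α)
          ≈⟨ solve 4 (λ i l u e → i :* l :* (u :* e) := i :* u :* l :* e)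
               refl (ι 2) (log u) u (ε ^ᴿ α) ⟩
        ι 2 * u * log u * ε ^ᴿ α          ≈⟨ *-congʳ (/-cancel (0<⇒≉0 0<D)) ⟨
        C * D * ε ^ᴿ α
          ≈⟨ solve 3 (λ c D e → c :* D :* e := D :* (c :* e)) refl C D (ε ^ᴿ α) ⟩
        D * (C * ε ^ᴿ α)                  ∎)
        where
        0<ε : 0# < ε
        0<ε = <-≤-trans 0<R R≤ε

        1≤uε^α : 1# ≤ u * ε ^ᴿ α
        1≤uε^α = begin
          1#                 ≤⟨ 1≤^ᴿ (proj₁ 0<α) (≤-trans 1≤uR (*-monoʳ-≤ (proj₁ 0<u) R≤ε)) ⟩
          (u * ε) ^ᴿ α       ≈⟨ uε^α 0<ε ⟩
          D * ε ^ᴿ α         ≤⟨ *-monoˡ-≤ (proj₁ (^ᴿ-positive α 0<ε)) D≤u ⟩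
          u * ε ^ᴿ α         ∎

      -- Passing from x, y to F x, F y multiplies ĝ x − ĝ y by d, and also the
      -- bound C εᵅ, as ε becomes u ε and uᵅ = d.
      ĝ-near : ∀ n {x y ε} → ¬ IsZero K x → ¬ IsZero K y → 0# < ε → δ x y ≤ ε → R ≤ ε * u ^ n →
               ĝ x - ĝ y ≤ C * ε ^ᴿ α
      -- The argument n bounds how often F must be applied before ε reaches R. The upper bound ε is
      -- tracked in place of the distance, since it grows by exactly u at each application.
      ĝ-near zero    x≢0 y≢0 0<ε δ≤ε R≤ε = ĝ-far x≢0 y≢0 (≤-respʳ-≈ (*-identityʳ _) R≤ε)
      ĝ-near (suc n) {x} {y} {ε} x≢0 y≢0 0<ε δ≤ε R≤εuⁿ⁺¹ with x≤y⊎y<x R ε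
      ... | inj₁ R≤ε = ĝ-far x≢0 y≢0 R≤ε
      ... | inj₂ ε<R = *-cancelˡ-≤ 0<D (begin
        D * (ĝ x - ĝ y)       ≤⟨ ĝ-step x≢0 y≢0 (≤-<-trans δ≤ε ε<R) ⟩
        ĝ (F x) - ĝ (F y)     ≤⟨ ĝ-near n (nonzero x≢0) (nonzero y≢0) (*-positive 0<u 0<ε) δF≤uε
                                   (≤-respʳ-≈ (solve 3 (λ ε u p → ε :* (u :* p) := u :* ε :* p)
                                        refl ε u (u ^ n)) R≤εuⁿ⁺¹) ⟩
        C * (u * ε) ^ᴿ α      ≈⟨ *-congˡ (uε^α 0<ε) ⟩
        C * (D * ε ^ᴿ α)      ≈⟨ solve 3 (λ c D e → c :* (D :* e) := D :* (c :* e)) refl C D (ε ^ᴿ α) ⟩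
        D * (C * ε ^ᴿ α)      ∎)
        where
        δF≤uε : δ (F x) (F y) ≤ u * ε
        δF≤uε = begin
          δ (F x) (F y)              ≈⟨ *-identityˡ _ ⟨
          1# * δ (F x) (F y)         ≤⟨ *-monoˡ-≤ (δ-nonneg (nonzero x≢0) (nonzero y≢0)) 1≤uR² ⟩
          u * R ^ 2 * δ (F x) (F y)  ≈⟨ *-assoc _ _ _ ⟩
          u * (R ^ 2 * δ (F x) (F y)) ≤⟨ *-monoʳ-≤ (proj₁ 0<u) (≤-trans (expansion x≢0 y≢0) δ≤ε) ⟩
          u * ε                      ∎

    ĝ-difference : ∀ {x y} → ¬ IsZero K x → ¬ IsZero K y → ĝ x - ĝ y ≤ C * δ x y ^ᴿ α
    ĝ-difference {x} {y} x≢0 y≢0 = decide (δ x y ≟ 0#)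
      where
      decide : Dec (δ x y ≈ 0#) → ĝ x - ĝ y ≤ C * δ x y ^ᴿ α
      -- Here the right-hand side is zero, by the convention for powers of zero.
      decide (yes δ≈0) = ≤-respʳ-≈ (sym (trans (*-congˡ (^ᴿ-zero α δ≈0)) (zeroʳ C))) (ĝ-degenerate x≢0 y≢0 δ≈0)
      -- As u ≥ 2, its n-th power is at least n, so n is chosen as an archimedean bound for
      -- `R / δ x y`.
      decide (no  δ≉0) = ĝ-near n x≢0 y≢0 0<δ ≤-refl (begin
        R                    ≈⟨ /-cancel δ≉0 ⟨
        R / δ x y * δ x y    ≤⟨ *-monoˡ-≤ (proj₁ 0<δ) (≤-trans R/δ≤n (ι≤^ n (≤-trans 2≤D D≤u))) ⟩
        u ^ n * δ x y        ≈⟨ *-comm _ _ ⟩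
        δ x y * u ^ n        ∎)
        where
        0<δ = ≉0⇒0< (δ-nonneg x≢0 y≢0) δ≉0
        n = proj₁ (archimedean (R / δ x y))
        R/δ≤n = proj₂ (archimedean (R / δ x y))

    ĝ-hölder : ∀ {x y} → ¬ IsZero K x → ¬ IsZero K y → ∣ ĝ x - ĝ y ∣ᴿ ≤ C * δ x y ^ᴿ α
    ĝ-hölder {x} {y} x≢0 y≢0 = ∣-∣-≤ (ĝ-difference x≢0 y≢0)
      (≤-respʳ-≈ (*-congˡ (^ᴿ-congˡ α (δ-sym y x))) (ĝ-difference y≢0 x≢0))

-- Bounds for an arbitrary lift, obtained from a minimal one

module LiftBounds
  {r r₁ r₂ c ℓ : Level} {ℝ : RealNumbers r r₁ r₂} {K : Field c ℓ} (closed : AlgebraicallyClosed K)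
  (v : NonarchimedeanAbsoluteValue ℝ K) (nontrivial : NonarchimedeanAbsoluteValue.Nontrivial v)
  (N d : ℕ) (φ : Func (Projective.ℙ K N) (Projective.ℙ K N))
  (Φ : Forms (Field.Carrier K) N (suc d)) (Φ-lift : Projective.IsLift K N φ Φ)
  (Ψ : Forms (Field.Carrier K) N (suc d)) (Ψ-lift : Projective.IsLift K N φ Ψ)
  (Ψ-minimal : Dynamics.Minimal v N Ψ)
  (Res : Polynomial (Coefficient N (suc d))) (isResultant : IsMacaulayResultant c ℓ N (suc d) Res)
  where
  open RealNumbers ℝ hiding (zero)
  open RealProperties ℝ hiding (∣∣-cong)
  open NonarchimedeanAbsoluteValue v
  open AbsoluteValueProperties v
  open NormProperties v N
  open Dynamics v N
  open QuasiHomogeneousMaps v N (suc d)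
  open IsMacaulayResultant isResultant using (vanishing)
  open ≤-Reasoning
  private
    module K where
      open Field K public
      open FieldProperties K public
      open IntegerSolver (Field.commutativeRing K) public

    V : Set c
    V = Vector K.Carrier (suc N)

    F F′ : V → V
    F  = evaluate (Field.commutativeRing K) Φ
    F′ = evaluate (Field.commutativeRing K) Ψ

    ρ : K.Carrier
    ρ = specialise (Field.commutativeRing K) Ψ Res

    integral : Integral Ψ
    integral = minimal⇒integral Ψ Ψ-minimal

    -- Both lifts represent the same point φ(π(x)). The scalar found here depends on x.
    proportional : ∀ x → ¬ IsZero K x → ∃ λ k → ∀ i → F x i K.≈ k K.* F′ x i
    proportional x x≢0 = proj₁ Φx∼Ψx , proj₂ (proj₂ Φx∼Ψx)
      where
      Φx Ψx φx : Point
      Φx = π (F x) (IsLift.nonzero Φ-lift x≢0)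
      Ψx = π (F′ x) (IsLift.nonzero Ψ-lift x≢0)
      φx = Func.to φ (π x x≢0)

      Φx∼Ψx : Φx ∼ Ψx
      Φx∼Ψx = Setoid.trans ℙ {Φx} {φx} {Ψx}
        (Setoid.sym ℙ {φx} {Φx} (IsLift.commutes Φ-lift x x≢0)) (IsLift.commutes Ψ-lift x x≢0)

    constant : ∃ λ k → k K.≉ K.0# × ∀ x i → F x i K.≈ k K.* F′ x i
    constant = ProportionalForms.constant-ratio K N d (nontrivial⇒infinite v nontrivial) Res
      (vanishing K closed) Φ Ψ (IsLift.noNontrivialZero Φ-lift) (IsLift.noNontrivialZero Ψ-lift) proportional

    κ : K.Carrier
    κ = proj₁ constant

    F≈κF′ : ∀ x i → F x i K.≈ κ K.* F′ x i
    F≈κF′ = proj₂ (proj₂ constant)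

    ∣F∣≤ : ∀ x i {b} → ∣ F′ x i ∣ ≤ b → ∣ F x i ∣ ≤ ∣ κ ∣ * b
    ∣F∣≤ x i ∣F′∣≤b = ≤-respˡ-≈ (∣∣-cong (K.sym (F≈κF′ x i))) (∣*∣≤ ≤-refl ∣F′∣≤b)

  bounds : Bounds F ∣ κ ∣ ∣ ρ ∣
  bounds = record
    { 0<k       = x≉0⇒0<∣x∣ (proj₁ (proj₂ constant))
    ; 0<R       = x≉0⇒0<∣x∣ (IsLift.noNontrivialZero Ψ-lift ∘ Equivalence.to (vanishing K closed Ψ))
    ; R≤1       = specialise-bound Ψ integral Res
    ; nonzero   = IsLift.nonzero Φ-lift
    ; upper     = upper
    ; lower     = lower
    ; lipschitz = lipschitz
    }
    where
    upper : ∀ x → ‖ F x ‖ ≤ ∣ κ ∣ * ‖ x ‖ ^ suc d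
    upper x = ‖‖-lub (F x) (*-nonneg (nonneg κ) (^-nonneg (suc d) (‖‖-nonneg x))) λ i →
      ∣F∣≤ x i (≤-trans (∣∣≤‖‖ (F′ x) i) (evaluate-bound Ψ integral x))

    lower : ∀ x → ¬ IsZero K x → ∣ κ ∣ * (∣ ρ ∣ * ‖ x ‖ ^ suc d) ≤ ‖ F x ‖
    lower x x≢0 = begin
      ∣ κ ∣ * (∣ ρ ∣ * ‖ x ‖ ^ suc d)  ≤⟨ *-monoʳ-≤ (nonneg κ) (evaluate-lower-bound Ψ integral Res
                                            (λ Φ′ → Equivalence.from (vanishing K closed Φ′)) x x≢0) ⟩
      ∣ κ ∣ * ‖ F′ x ‖                 ≈⟨ *-congˡ (proj₂ (‖‖-attained (F′ x))) ⟨
      ∣ κ ∣ * ∣ F′ x j ∣               ≈⟨ ∣∣-* κ (F′ x j) ⟨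
      ∣ κ K.* F′ x j ∣                 ≈⟨ ∣∣-cong (F≈κF′ x j) ⟨
      ∣ F x j ∣                        ≤⟨ ∣∣≤‖‖ (F x) j ⟩
      ‖ F x ‖                          ∎
      where
      j = proj₁ (‖‖-attained (F′ x))

    lipschitz : ∀ {x y} → ¬ IsZero K x → ¬ IsZero K y → ∀ i j →
      ∣ y i K.^ suc d K.* F x j K.- x i K.^ suc d K.* F y j ∣ ≤ ∣ κ ∣ * (δ x y * (‖ x ‖ * ‖ y ‖) ^ suc d)
    lipschitz {x} {y} x≢0 y≢0 i j = ≤-respˡ-≈
      (∣∣-cong (K.trans (K.solve 5 (λ k X Y P Q → k K.:* (Y K.:* P K.:- X K.:* Q) K.:=
             Y K.:* (k K.:* P) K.:- X K.:* (k K.:* Q))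
                  K.refl κ (x i K.^ suc d) (y i K.^ suc d) (F′ x j) (F′ y j))
                (K.+-cong (K.*-congˡ (K.sym (F≈κF′ x j))) (K.-‿cong (K.*-congˡ (K.sym (F≈κF′ y j)))))))
      (∣*∣≤ ≤-refl (evaluate-lipschitz Ψ integral x≢0 y≢0 i j))

theorem17 :
    ∀ {r r₁ r₂ c ℓ} (ℝ : RealNumbers r r₁ r₂)
    (K : Field c ℓ) → AlgebraicallyClosed K →
    (v : NonarchimedeanAbsoluteValue ℝ K) →
    let open NonarchimedeanAbsoluteValue v
        open RealNumbers ℝ
    in
    Nontrivial → Complete →
    (N d : ℕ) → 2 ℕ.≤ d →
    let open Dynamics v N in
    (φ : Func ℙ ℙ)
    (Φ : Forms (Field.Carrier K) N d) → IsLift φ Φ →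
    (Ψ : Forms (Field.Carrier K) N d) → IsLift φ Ψ → Minimal Ψ →
    (Res : Polynomial (Coefficient N d)) → IsMacaulayResultant c ℓ N d Res →
    (G : Vector (Field.Carrier K) (ℕ.suc N) → Carrier) →
    IsGreenFunction Φ G →
    let ĝ    = modified G
        ∣Res∣ = ∣ specialise (Field.commutativeRing K) Ψ Res ∣
        u    = (ι 2 * ι d) ⊔ (∣Res∣ ^ 2) ⁻¹
    in
    (∀ P Q → ∣ ĝ P - ĝ Q ∣ᴿ ≤
             (ι 2 * u * log u / ι d) * Δ P Q ^ᴿ (log (ι d) / log u))
    × HölderContinuous ĝ
-- Since 2 ≤ d, only a successor degree occurs; positivity is what the comparison of the two lifts
-- relies on.
theorem17 ℝ K closed v nontrivial _ N (suc d) 2≤d φ Φ Φ-lift Ψ Ψ-lift Ψ-minimal Res isResultant G green =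
  estimate , C , α , 0<C , 0<α , α≤1 , estimate
  where
  open RealNumbers ℝ hiding (zero)
  open RealProperties ℝ
  open Dynamics v N
  open LiftBounds closed v nontrivial N d φ Φ Φ-lift Ψ Ψ-lift Ψ-minimal Res isResultant
  open GreenFunctionEstimates v N (suc d) 2≤d bounds G green
  open ≤-Reasoning

  R u : Carrier
  R = NonarchimedeanAbsoluteValue.∣_∣ v (specialise (Field.commutativeRing K) Ψ Res)
  u = (ι 2 * ι (suc d)) ⊔ (R ^ 2) ⁻¹

  0<R² : 0# < R ^ 2
  0<R² = ^-positive 2 (QuasiHomogeneousMaps.Bounds.0<R bounds)

  1≤uR² : 1# ≤ u * R ^ 2
  1≤uR² = begin
    1#                   ≈⟨ ⁻¹-inverseˡ (0<⇒≉0 0<R²) ⟨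
    (R ^ 2) ⁻¹ * R ^ 2   ≤⟨ *-monoˡ-≤ (proj₁ 0<R²) (x≤y⊔x _ _) ⟩
    u * R ^ 2            ∎

  open Exponent u (x≤x⊔y _ _) 1≤uR²

  estimate : ∀ P Q → ∣ modified G P - modified G Q ∣ᴿ ≤ C * Δ P Q ^ᴿ α
  estimate (_ , x≢0) (_ , y≢0) = ĝ-hölder x≢0 y≢0
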